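{- Let $G$ be one of the consolidated Tait graphs $G_B^*$, $G_W^*$ of an oriented non-split alternating link, with $n$ vertices, weighted adjacency matrix $\overline A$ and ordinary ($0/1$) adjacency matrix $A=A(G)$, let $\det(\lambda I-A)=\lambda^n+c_1\lambda^{n-1}+\cdots+c_n$, and let $q\ge1$ be an integer with $2q+1\le n$. If the components corresponding to $G$ of $CWR_3,CWR_5,\ldots,CWR_{2q-1}$ all vanish (a vacuous condition when $q=1$), then $$\left.C_{2q+1}(\overline A)\right|_{w=r=1}=-\frac12c_{2q+1}.$$ Equivalently, when $2q+1$ is the length of the shortest odd cycle of $G$, the number of such shortest odd cycles is $-c_{2q+1}/2$.
   Context: Tait graphs and $CWR$. Let $D$ be a reduced (no nugatory crossings) alternating diagram of an oriented non-split alternating link $L$. The regions of $D$ are checkerboard coloured black and white, so that regions sharing an edge have opposite colours; which class is called black is fixed once and for all by a local rule depending on the over/under pattern at crossings, the same rule for all diagrams (the statement holds for either choice of rule). The Tait graph $G_B$ has one vertex for each black region and one edge for each crossing, joining the black regions meeting at that crossing; $G_W$ is defined in the same way from white regions. Each edge $e$ gets weight $\operatorname{wg}(e)=w$ if the crossing is positive and $r$ if it is negative, where $w,r$ are commuting indeterminates. The consolidated Tait graph $G_B^*$ is the weighted simple graph obtained from $G_B$ by replacing all parallel edges joining the same pair of vertices by a single edge whose weight is the product of their weights (so every edge weight is a monomial in $w,r$); $G_W^*$ is obtained from $G_W$ likewise. For $i>2$, $CB_i(w,r)=\sum_C\prod_{e\in E(C)}\operatorname{wg}(e)$, summed over all unoriented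 simple cycles $C$ of length $i$ in $G_B^*$ (zero if there are none); $CW_i$ is defined analogously from $G_W^*$; and $CWR_i=(CB_i,CW_i)$. The component of $CWR_i$ corresponding to $G$ is $CB_i$ if $G=G_B^*$ and $CW_i$ if $G=G_W^*$. The weighted adjacency matrix $\overline A$ has $(i,j)$ entry equal to the weight of the edge $v_iv_j$ if it exists, and $0$ otherwise. $C_k(\overline A)$ is the total weight of the unoriented simple $k$-cycles of $G$, the weight of a cycle being the product of its edge weights (so $C_k(\overline A)$ is the component of $CWR_k$ corresponding to $G$). -}

module Defs where

open import Algebra.Bundles.Raw using (RawRing)
open import Data.Bool.Base using (Bool; not; if_then_else_)
import Data.Bool.Properties as Bool
open import Data.Empty using (⊥)
open import Data.Fin.Base using (Fin; zero; suc; _<_)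
open import Data.Fin.Patterns using (0F; 1F; 2F; 3F)
open import Data.Fin.Properties using (_≟_; _<?_; any?)
open import Data.Integer.Base as ℤ using (ℤ)
open import Data.List.Base as List using (List; []; _∷_; allFin; cartesianProduct; cartesianProductWith; filter; foldr; length; map)
open import Data.List.Properties using (filter-≐)
open import Data.Nat.Base as ℕ using (ℕ; zero; suc)
open import Data.Product using (∃; ∃-syntax; _×_; _,_; proj₁; proj₂)
open import Data.Sum using (_⊎_; inj₁; inj₂)
open import Data.Vec.Base as Vec using (Vec; []; _∷_; _∷ʳ_; last; lookup; zip)
open import Data.Vec.Relation.Unary.All using (All; all?)
open import Data.Vec.Relation.Unary.AllPairs using (allPairs?)
open import Data.Vec.Relation.Unary.Unique.Propositional using (Unique)
open import Function.Base using (_∘_)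
open import Function.Bundles using (_⇔_; module Equivalence)
open import Function.Definitions using (StrictlySurjective)
open import Level using (0ℓ)
open import Relation.Binary.Construct.Closure.ReflexiveTransitive using (Star)
open import Relation.Binary.Definitions using (DecidableEquality; Decidable; Symmetric; Irreflexive)
open import Relation.Binary.PropositionalEquality using (_≡_; _≢_; refl; sym; trans; cong)
open import Relation.Nullary using (¬_; Dec; yes; no; does)
open import Relation.Nullary.Decidable using (_×-dec_; ¬?)

------------------------------------------------------------------------
-- Finite sums and products, polynomials, determinants

module _ {a ℓ} (R : RawRing a ℓ) where
  open RawRing R

  sum : List Carrier → Carrier
  sum = foldr _+_ 0#

  product : List Carrier → Carrier
  product = foldr _*_ 1#

  -- A polynomial is its list of coefficients, constant term first;
  -- trailing zeros are allowed and ignored by the equality of R[X].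

  coeff : List Carrier → ℕ → Carrier
  coeff []       _       = 0#
  coeff (c ∷ _)  zero    = c
  coeff (_ ∷ cs) (suc i) = coeff cs i

  eval : Carrier → List Carrier → Carrier
  eval x = foldr (λ c v → c + x * v) 0#

  infixl 6 _⊕_
  infixl 7 _⊛_

  _⊕_ : List Carrier → List Carrier → List Carrier
  []       ⊕ ds       = ds
  (c ∷ cs) ⊕ []       = c ∷ cs
  (c ∷ cs) ⊕ (d ∷ ds) = (c + d) ∷ (cs ⊕ ds)

  _⊛_ : List Carrier → List Carrier → List Carrier
  []       ⊛ ds = []
  (c ∷ cs) ⊛ ds = map (c *_) ds ⊕ (0# ∷ (cs ⊛ ds))

_[X] : ∀ {a ℓ} → RawRing a ℓ → RawRing a ℓ
R [X] = record
  { Carrier = List Carrier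
  ; _≈_     = λ p q → ∀ i → coeff R p i ≈ coeff R q i
  ; _+_     = _⊕_ R
  ; _*_     = _⊛_ R
  ; -_      = map (-_)
  ; 0#      = []
  ; 1#      = 1# ∷ []
  }
  where open RawRing R

const : ∀ {a ℓ} (R : RawRing a ℓ) → RawRing.Carrier R → RawRing.Carrier (R [X])
const R c = c ∷ []

indeterminate : ∀ {a ℓ} (R : RawRing a ℓ) → RawRing.Carrier (R [X])
indeterminate R = 0# ∷ 1# ∷ [] where open RawRing R

ℤ-ring : RawRing _ _
ℤ-ring = ℤ.+-*-rawRing

-- ℤ[w,r] is built as (ℤ[w])[r].

ℤ[w,r] : RawRing _ _
ℤ[w,r] = (ℤ-ring [X]) [X]

w r : RawRing.Carrier ℤ[w,r]
w = const (ℤ-ring [X]) (indeterminate ℤ-ring)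
r = indeterminate (ℤ-ring [X])

_∣w=r=1 : RawRing.Carrier ℤ[w,r] → ℤ
p ∣w=r=1 = eval ℤ-ring ℤ.1ℤ (eval (ℤ-ring [X]) (RawRing.1# (ℤ-ring [X])) p)

words : ∀ n k → List (Vec (Fin n) k)
words n zero    = [] ∷ []
words n (suc k) = cartesianProductWith _∷_ (allFin n) (words n k)

unique? : ∀ {n k} (u : Vec (Fin n) k) → Dec (Unique u)
unique? = allPairs? (λ i j → ¬? (i ≟ j))

Matrix : Set → ℕ → Set
Matrix A n = Fin n → Fin n → A

-- A permutation σ is listed as σ(0), …, σ(n-1).

permutations : ∀ n → List (Vec (Fin n) n)
permutations n = filter unique? (words n n)

inversions : ∀ {n} → Vec (Fin n) n → List (Fin n × Fin n)
inversions {n} σ =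
  filter (λ (i , j) → (i <? j) ×-dec (lookup σ j <? lookup σ i))
         (cartesianProduct (allFin n) (allFin n))

module _ {ℓ} (R : RawRing 0ℓ ℓ) where
  open RawRing R

  sign : ∀ {n} → Vec (Fin n) n → Carrier
  sign σ = foldr (λ _ s → - s) 1# (inversions σ)

  det : ∀ {n} → Matrix Carrier n → Carrier
  det {n} M = sum R (map term (permutations n))
    where
    term : Vec (Fin n) n → Carrier
    term σ = sign σ * product R (map (λ i → M i (lookup σ i)) (allFin n))

-- det(λI - A), an element of ℤ[λ].

charPoly : ∀ {n} → Matrix ℤ n → RawRing.Carrier (ℤ-ring [X])
charPoly A = det (ℤ-ring [X]) λ i j →
    (if does (i ≟ j) then indeterminate ℤ-ring else 0#) + - const ℤ-ring (A i j)
  where open RawRing (ℤ-ring [X])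

-- The coefficient c_k of λ^(n-k) in det(λI - A); meant for k ≤ n only.

c : ∀ {n} → Matrix ℤ n → ℕ → ℤ
c {n} A k = coeff ℤ-ring (charPoly A) (n ℕ.∸ k)

------------------------------------------------------------------------
-- Weighted simple graphs and their cycles

-- The value of weight on non-adjacent pairs carries no meaning.

record WeightedSimpleGraph (W : Set) : Set₁ where
  field
    n          : ℕ
    Adj        : Fin n → Fin n → Set
    adj?       : Decidable Adj
    adj-sym    : Symmetric Adj
    adj-irrefl : Irreflexive _≡_ Adj
    weight     : Fin n → Fin n → W
    weight-sym : ∀ i j → weight i j ≡ weight j i

module _ {W : Set} (G : WeightedSimpleGraph W) where
  open WeightedSimpleGraph G

  adjacency : Matrix ℤ n
  adjacency i j = if does (adj? i j) then ℤ.1ℤ else ℤ.0ℤ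

  -- The cyclically consecutive pairs of u, including (last, first).

  steps : ∀ {k} → Vec (Fin n) k → Vec (Fin n × Fin n) k
  steps []       = []
  steps (v ∷ vs) = zip (v ∷ vs) (vs ∷ʳ v)

  -- An unoriented simple cycle has exactly one vertex sequence that starts
  -- at its least vertex and leaves towards the smaller of the two
  -- neighbours of that vertex on the cycle.  The second condition is
  -- contradictory for sequences of length 2.

  Canonical : ∀ {k} → Vec (Fin n) k → Set
  Canonical []             = ⊥
  Canonical (_ ∷ [])       = ⊥
  Canonical (v ∷ v₁ ∷ vs) = All (v <_) (v₁ ∷ vs) × v₁ < last (v₁ ∷ vs)

  canonical? : ∀ {k} (u : Vec (Fin n) k) → Dec (Canonical u)
  canonical? []             = no λ ()
  canonical? (_ ∷ [])       = no λ ()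
  canonical? (v ∷ v₁ ∷ vs) =
    all? (v <?_) (v₁ ∷ vs) ×-dec (v₁ <? last (v₁ ∷ vs))

  IsCycle : ∀ {k} → Vec (Fin n) k → Set
  IsCycle u = Unique u × All (λ (i , j) → Adj i j) (steps u) × Canonical u

  isCycle? : ∀ {k} (u : Vec (Fin n) k) → Dec (IsCycle u)
  isCycle? u =
    unique? u ×-dec all? (λ (i , j) → adj? i j) (steps u) ×-dec canonical? u

  cycles : ∀ k → List (Vec (Fin n) k)
  cycles k = filter isCycle? (words n k)

  HasCycle : ℕ → Set
  HasCycle k = ∃[ u ] IsCycle {k} u

  ShortestOddCycleLength : ℕ → Set
  ShortestOddCycleLength k =
    HasCycle k × Odd k × (∀ m → Odd m → HasCycle m → k ℕ.≤ m)
    where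
    Odd : ℕ → Set
    Odd m = ∃[ p ] m ≡ 2 ℕ.* p ℕ.+ 1

module _ {ℓ} (R : RawRing 0ℓ ℓ) (G : WeightedSimpleGraph (RawRing.Carrier R)) where
  open RawRing R
  open WeightedSimpleGraph G

  weightedAdjacency : Matrix Carrier n
  weightedAdjacency i j = if does (adj? i j) then weight i j else 0#

  -- The total weight of the k-cycles of G, an edge ij having weight M i j.

  cycleSum : ℕ → Matrix Carrier n → Carrier
  cycleSum k M =
    sum R (map (λ u → product R (map (λ (i , j) → M i j) (Vec.toList (steps G u))))
               (cycles G k))

------------------------------------------------------------------------
-- Link diagrams

-- Each crossing has four darts (outgoing half-edges), numbered
-- counterclockwise so that 0, 2 lie on the under-strand and 1, 3 on the
-- over-strand.

Dart : ℕ → Set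
Dart crossings = Fin crossings × Fin 4

module _ {m : ℕ} where

  ccw : Dart m → Dart m
  ccw (x , 0F) = x , 1F
  ccw (x , 1F) = x , 2F
  ccw (x , 2F) = x , 3F
  ccw (x , 3F) = x , 0F

  opposite : Dart m → Dart m
  opposite = ccw ∘ ccw

  cw : Dart m → Dart m
  cw = ccw ∘ opposite

  data Under : Dart m → Set where
    under₀ : ∀ {x} → Under (x , 0F)
    under₂ : ∀ {x} → Under (x , 2F)

-- An oriented link diagram on the sphere with connected underlying
-- projection, as a combinatorial map with numbered crossings and regions.
--
-- Connectedness stands for non-splitness of the link: a disconnected
-- diagram presents a split link, and a connected alternating diagram
-- presents a non-split one (Menasco).  The crossingless circle is not
-- represented.
--
-- The dart d also names the corner of its crossing between d and ccw d.
-- Walking along d with that corner on the left, one arrives at the corner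
-- cw (edge d), so the regions are the orbits of cw ∘ edge; the corners d
-- and edge d lie on the two sides of the edge containing d.

record Diagram : Set where
  field
    crossings    : ℕ
    edge         : Dart crossings → Dart crossings
    edge-invol   : ∀ d → edge (edge d) ≡ d
    edge-nofix   : ∀ d → edge d ≢ d
    connected    : ∀ d e → Star (λ x y → y ≡ edge x ⊎ y ≡ ccw x) d e

  SameRegion : Dart crossings → Dart crossings → Set
  SameRegion = Star (λ x y → y ≡ cw (edge x))

  field
    regions      : ℕ
    region       : Dart crossings → Fin regions
    region-surj  : StrictlySurjective _≡_ region
    region-orbit : ∀ d e → region d ≡ region e ⇔ SameRegion d e

    -- Planarity, by Euler's formula; there are 2 * crossings edges.
    euler        : crossings ℕ.+ regions ≡ 2 ℕ.* crossings ℕ.+ 2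

    -- outward d: the strand is oriented away from the crossing along d.
    outward      : Dart crossings → Bool
    outward-edge : ∀ d → outward (edge d) ≡ not (outward d)
    outward-thru : ∀ d → outward (opposite d) ≡ not (outward d)

module _ (D : Diagram) where
  open Diagram D

  Alternating : Set
  Alternating = ∀ d → Under d ⇔ (¬ Under (edge d))

  -- A closed curve meeting the diagram only in the crossing x, and
  -- transversally there, runs inside a single region between two opposite
  -- corners of x.

  Nugatory : Fin crossings → Set
  Nugatory x = ∃[ i ] SameRegion (x , i) (opposite (x , i))

  Reduced : Set
  Reduced = ∀ x → ¬ Nugatory x

  -- A crossing is positive when turning the over-strand counterclockwise by
  -- a quarter turn gives the direction of the under-strand, that is, when
  -- over and under point along the darts 3 and 0, or along 1 and 2.

  wg : Fin crossings → RawRing.Carrier ℤ[w,r]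
  wg x = if does (outward (x , 0F) Bool.≟ outward (x , 3F)) then w else r

data Colour : Set where
  black white : Colour

_≟ᶜ_ : DecidableEquality Colour
black ≟ᶜ black = yes refl
black ≟ᶜ white = no λ ()
white ≟ᶜ black = no λ ()
white ≟ᶜ white = yes refl

-- The local rule ρ is the colour of the corners lying counterclockwise
-- next to an under-dart.

record Checkerboard (D : Diagram) (ρ : Colour) : Set where
  open Diagram D
  field
    colour     : Fin regions → Colour
    alternates : ∀ d → colour (region d) ≢ colour (region (edge d))
    local-rule : ∀ d → Under d → colour (region d) ≡ ρ

module _ (D : Diagram) (reduced : Reduced D) {ρ} (χ : Checkerboard D ρ) where
  open Diagram D
  open Checkerboard χ

  vertices : Colour → List (Fin regions)
  vertices κ = filter (λ s → colour s ≟ᶜ κ) (List.allFin regions)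

  -- The crossing x is an edge joining s and t in a Tait graph.  This is
  -- symmetric in s and t because i may be replaced by the opposite corner.

  Joins : Fin crossings → Fin regions → Fin regions → Set
  Joins x s t = ∃[ i ] region (x , i) ≡ s × region (opposite (x , i)) ≡ t

  joins? : ∀ s t x → Dec (Joins x s t)
  joins? s t x = any? λ i → (region (x , i) ≟ s) ×-dec (region (opposite (x , i)) ≟ t)

  joins-sym : ∀ {x s t} → Joins x s t → Joins x t s
  joins-sym (0F , p , q) = 2F , q , p
  joins-sym (1F , p , q) = 3F , q , p
  joins-sym (2F , p , q) = 0F , q , p
  joins-sym (3F , p , q) = 1F , q , p

  joins-irrefl : ∀ {x s} → ¬ Joins x s s
  joins-irrefl {x} (i , p , q) =
    reduced x (i , Equivalence.to (region-orbit _ _) (trans p (sym q)))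

  parallelWeight : Fin regions → Fin regions → RawRing.Carrier ℤ[w,r]
  parallelWeight s t = product ℤ[w,r] (map (wg D) (filter (joins? s t) (allFin crossings)))

  -- The consolidated Tait graph on the regions of colour κ.

  consolidatedTait : Colour → WeightedSimpleGraph (RawRing.Carrier ℤ[w,r])
  consolidatedTait κ = record
    { n          = length (vertices κ)
    ; Adj        = λ i j → ∃[ x ] Joins x (vert i) (vert j)
    ; adj?       = λ i j → any? (joins? (vert i) (vert j))
    ; adj-sym    = λ (x , J) → x , joins-sym J
    ; adj-irrefl = λ { refl (x , J) → joins-irrefl J }
    ; weight     = λ i j → parallelWeight (vert i) (vert j)
    ; weight-sym = λ i j → cong (product ℤ[w,r] ∘ map (wg D))
        (filter-≐ (joins? (vert i) (vert j)) (joins? (vert j) (vert i))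
                  (joins-sym , joins-sym) (allFin crossings))
    }
    where
    vert : Fin (length (vertices κ)) → Fin regions
    vert = List.lookup (vertices κ)

  CB CW : ℕ → RawRing.Carrier ℤ[w,r]
  CB i = cycleSum ℤ[w,r] G i (WeightedSimpleGraph.weight G)
    where G = consolidatedTait black
  CW i = cycleSum ℤ[w,r] G i (WeightedSimpleGraph.weight G)
    where G = consolidatedTait white

  CWR : ℕ → RawRing.Carrier ℤ[w,r] × RawRing.Carrier ℤ[w,r]
  CWR i = CB i , CW i

component : ∀ {A : Set} → Colour → A × A → A
component black = proj₁
component white = proj₂

{-# OPTIONS --safe #-}

-- Put w = r = 1: every edge weight becomes 1, so the vanishing of the CWR components says that G has
-- no odd cycle of length less than k = 2q+1.  Expand det(λI - A) over permutations: the coefficient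
-- c_k collects the permutations σ moving exactly k points, each along an edge of G, with sign
-- (-1)^k sign(σ).  As k is odd, some orbit of moved points is odd, hence an odd cycle of G, hence has
-- length at least k and contains all moved points.  So σ is a k-cycle; it is the square of
-- σ^(q+1), hence even, and contributes -1.  Every k-cycle of G arises from two such σ, one for each
-- direction.
module Submission where

open import Defs
open import Algebra.Bundles using (CommutativeMonoid)
open import Algebra.Bundles.Raw using (RawRing)
open import Algebra.Properties.CommutativeSemigroup using (interchange)
open import Data.Bool.Base using (true; false; if_then_else_)
import Data.Bool.Properties as Bool
open import Data.Fin.Base as Fin using (Fin; zero; suc; toℕ; fromℕ; inject₁)
open import Data.Fin.Induction using (<-weakInduction)
import Data.Fin.Properties as Fin
open import Data.Fin.Relation.Unary.Top using (view; view-fromℕ; view-inject₁; ‵fromℕ; ‵inject₁)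
open import Data.Integer.Base as ℤ using (ℤ; +_)
import Data.Integer.Properties as ℤ
open import Data.List.Base as List using (List; []; _∷_; length; filter; map; allFin; cartesianProduct)
open import Data.List.Membership.Propositional using (_∈_)
open import Data.List.Membership.Propositional.Properties
  using (∈-lookup; ∈-filter⁺; ∈-filter⁻; ∈-allFin; ∈-cartesianProduct⁺; ∈-cartesianProductWith⁺)
import Data.List.Properties as List
open import Data.List.Relation.Unary.Any using (index; here; there)
open import Data.List.Relation.Unary.Any.Properties using (lookup-index)
open import Data.List.Relation.Unary.All as ListAll using ([]; _∷_)
open import Data.List.Relation.Unary.AllPairs using () renaming ([] to []ₚ; _∷_ to _∷ₚ_)
import Data.List.Relation.Unary.Unique.Propositional as List
import Data.List.Relation.Unary.Unique.Propositional.Properties as Unique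
open import Data.Nat.Base using (ℕ; zero; suc; _+_; _*_; _∸_; _≤_; _<_; s≤s; z≤n)
open import Data.Nat.GeneralisedArithmetic using (fold; fold-+)
open import Data.Nat.Induction using (<-rec)
import Data.Nat.Properties as ℕ
open import Data.Product using (_×_; _,_; proj₁; proj₂; ∃-syntax)
open import Data.Rational.Base as ℚ using (ℚ; -½; _/_; toℚᵘ)
import Data.Rational.Properties as ℚ
open import Data.Rational.Unnormalised.Base as ℚᵘ using (mkℚᵘ; _≃_; *≡*)
import Data.Rational.Unnormalised.Properties as ℚᵘ
open import Data.Sum using (_⊎_; inj₁; inj₂; [_,_]; swap)
open import Data.Vec.Base as Vec using (Vec; []; _∷_; _∷ʳ_; lookup; tabulate; last)
import Data.Vec.Properties as Vec
open import Data.Vec.Relation.Unary.All as All using (All)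
import Data.Vec.Relation.Unary.All.Properties as All
open import Data.Vec.Relation.Unary.Unique.Propositional using (Unique)
import Data.Vec.Relation.Unary.Unique.Propositional.Properties as VecUnique
open import Function.Base using (_∘_; id)
open import Function.Definitions using (Injective)
open import Level using (0ℓ)
open import Relation.Binary.Definitions using (tri<; tri≈; tri>)
open import Relation.Binary.PropositionalEquality
  using (_≡_; _≢_; refl; sym; trans; cong; cong₂; subst; subst₂; module ≡-Reasoning)
open import Relation.Nullary using (¬_; yes; no; does; contradiction)
open import Relation.Nullary.Decidable
  using (_×-dec_; _⊎-dec_; _→-dec_; ¬?; decidable-stable; dec-true; dec-false)
open import Relation.Unary using (Decidable)

-- Counting by matching

-- The proof works without cycle decompositions and without multiplicativity of the sign: an orbit
-- is reached by iterating an injective map up to its least return, and the parity of a square is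
-- read off its list of inversions. All counts are lengths of filtered lists, compared through
-- relations that are total and injective in both directions. The relation joining the algebra to
-- the graph is `Traces`, between a permutation and a word that it follows. Rooting words at their
-- least vertex removes the choice of a starting point and leaves only the choice of a direction.
-- The hypothesis on `CWR` and the one on shortest odd cycles meet in `c-oddGirth`, whose assumption
-- speaks of cycles alone, so the weights enter only through their values at w = r = 1.

lookup-injective : ∀ {A : Set} {xs : List A} → List.Unique xs →
  ∀ i j → List.lookup xs i ≡ List.lookup xs j → i ≡ j
lookup-injective (_ ∷ₚ _)    zero    zero    eq = refl
lookup-injective (x∉ ∷ₚ xs!) zero    (suc j) eq = contradiction eq (ListAll.lookup x∉ (∈-lookup j))
lookup-injective (x∉ ∷ₚ xs!) (suc i) zero    eq = contradiction (sym eq) (ListAll.lookup x∉ (∈-lookup i))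
lookup-injective (x∉ ∷ₚ xs!) (suc i) (suc j) eq = cong suc (lookup-injective xs! i j eq)

embedding⇒≤ : ∀ {A : Set} {k} {ys : List A} (f : Fin k → A) → Injective _≡_ _≡_ f →
  (∀ i → f i ∈ ys) → k ≤ length ys
embedding⇒≤ {ys = ys} f f-injective f∈ys = Fin.injective⇒≤ {f = index ∘ f∈ys} λ {i} {j} eq →
  f-injective (trans (lookup-index (f∈ys i))
    (trans (cong (List.lookup ys) eq) (sym (lookup-index (f∈ys j)))))

-- Pigeonhole: a missed `y` together with the values of `f` would make `suc k` distinct members of a
-- list of length `k`.
embedding-surjective : ∀ {n k} {ys : List (Fin n)} (f : Fin k → Fin n) → Injective _≡_ _≡_ f →
  (∀ i → f i ∈ ys) → length ys ≡ k → ∀ {y} → y ∈ ys → ∃[ i ] f i ≡ y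
embedding-surjective {n} {k} {ys} f f-injective f∈ys refl {y} y∈ys
  with Fin.any? (λ i → f i Fin.≟ y)
... | yes found = found
... | no ¬found = contradiction (embedding⇒≤ g g-injective g∈ys) ℕ.1+n≰n
  where
  g : Fin (suc k) → Fin n
  g zero    = y
  g (suc i) = f i

  g-injective : Injective _≡_ _≡_ g
  g-injective {zero}  {zero}  eq = refl
  g-injective {zero}  {suc j} eq = contradiction (j , sym eq) ¬found
  g-injective {suc i} {zero}  eq = contradiction (i , eq) ¬found
  g-injective {suc i} {suc j} eq = cong suc (f-injective eq)

  g∈ys : ∀ i → g i ∈ ys
  g∈ys zero    = y∈ys
  g∈ys (suc i) = f∈ys i

-- A relation takes the place of a function so that one and the same correspondence, read backwards,
-- yields the opposite inequality in `matching⇒≡`.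
matching⇒≤ : ∀ {A B : Set} {xs : List A} {ys : List B} (R : A → B → Set) → List.Unique xs →
  (∀ {x} → x ∈ xs → ∃[ y ] y ∈ ys × R x y) →
  (∀ {x x′ y} → x ∈ xs → x′ ∈ xs → R x y → R x′ y → x ≡ x′) →
  length xs ≤ length ys
matching⇒≤ {xs = xs} {ys} R xs! total inj = embedding⇒≤ (proj₁ ∘ image)
  (λ {i} {j} eq → lookup-injective xs! i j (inj (∈-lookup i) (∈-lookup j)
    (subst (R _) eq (proj₂ (proj₂ (image i)))) (proj₂ (proj₂ (image j)))))
  (proj₁ ∘ proj₂ ∘ image)
  where
  image : ∀ i → ∃[ y ] y ∈ ys × R (List.lookup xs i) y
  image i = total (∈-lookup i)

matching⇒≡ : ∀ {A B : Set} {xs : List A} {ys : List B} (R : A → B → Set) →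
  List.Unique xs → List.Unique ys →
  (∀ {x} → x ∈ xs → ∃[ y ] y ∈ ys × R x y) →
  (∀ {y} → y ∈ ys → ∃[ x ] x ∈ xs × R x y) →
  (∀ {x x′ y} → x ∈ xs → x′ ∈ xs → R x y → R x′ y → x ≡ x′) →
  (∀ {x y y′} → y ∈ ys → y′ ∈ ys → R x y → R x y′ → y ≡ y′) →
  length xs ≡ length ys
matching⇒≡ R xs! ys! totalˡ totalʳ injˡ injʳ = ℕ.≤-antisym
  (matching⇒≤ R xs! totalˡ injˡ)
  (matching⇒≤ (λ y x → R x y) ys! totalʳ injʳ)

length-filter-⊎ : ∀ {A : Set} {P Q S : A → Set}
  (P? : Decidable P) (Q? : Decidable Q) (S? : Decidable S) →
  (∀ {x} → P x → Q x ⊎ S x) → (∀ {x} → Q x → P x) → (∀ {x} → S x → P x) →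
  (∀ {x} → Q x → ¬ S x) →
  ∀ xs → length (filter P? xs) ≡ length (filter Q? xs) + length (filter S? xs)
length-filter-⊎ P? Q? S? split Q⇒P S⇒P disjoint []       = refl
length-filter-⊎ P? Q? S? split Q⇒P S⇒P disjoint (x ∷ xs)
  with ih ← length-filter-⊎ P? Q? S? split Q⇒P S⇒P disjoint xs | P? x | Q? x | S? x
... | _     | yes q | yes s = contradiction s (disjoint q)
... | yes p | yes q | no _  = cong suc ih
... | yes p | no _  | yes s = trans (cong suc ih) (sym (ℕ.+-suc _ _))
... | yes p | no ¬q | no ¬s = contradiction (split p) [ ¬q , ¬s ]
... | no ¬p | yes q | _     = contradiction (Q⇒P q) ¬p
... | no ¬p | _     | yes s = contradiction (S⇒P s) ¬p
... | no _  | no _  | no _  = ih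

words-complete : ∀ {n k} (u : Vec (Fin n) k) → u ∈ words n k
words-complete []      = here refl
words-complete (x ∷ u) = ∈-cartesianProductWith⁺ _∷_ (∈-allFin x) (words-complete u)

words-unique : ∀ n k → List.Unique (words n k)
words-unique n zero    = ListAll.[] ∷ₚ []ₚ
words-unique n (suc k) =
  Unique.cartesianProductWith⁺ _∷_ Vec.∷-injective (Unique.allFin⁺ n) (words-unique n k)

-- Parity and least elements

Odd : ℕ → Set
Odd l = ∃[ h ] l ≡ suc (h + h)

parity : ∀ l → (∃[ h ] l ≡ h + h) ⊎ Odd l
parity zero    = inj₁ (0 , refl)
parity (suc l) with parity l
... | inj₁ (h , refl) = inj₂ (h , refl)
... | inj₂ (h , refl) = inj₁ (suc h , cong suc (sym (ℕ.+-suc h h)))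

double≢odd : ∀ h j → h + h ≢ suc (j + j)
double≢odd zero    j       ()
double≢odd (suc h) zero    eq = contradiction (trans (sym (ℕ.+-suc h h)) (ℕ.suc-injective eq)) λ ()
double≢odd (suc h) (suc j) eq = double≢odd h j
  (ℕ.suc-injective (trans (sym (ℕ.+-suc h h)) (trans (ℕ.suc-injective eq) (cong suc (ℕ.+-suc j j)))))

double-injective : ∀ h j → h + h ≡ j + j → h ≡ j
double-injective zero    zero    eq = refl
double-injective (suc h) (suc j) eq = cong suc (double-injective h j
  (ℕ.suc-injective (trans (sym (ℕ.+-suc h h)) (trans (ℕ.suc-injective eq) (ℕ.+-suc j j)))))

odd? : Decidable Odd
odd? l with parity l
... | inj₂ o        = yes o
... | inj₁ (h , eq) = no λ (j , eq′) → double≢odd h j (trans (sym eq) eq′)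

least : ∀ {P : ℕ → Set} → Decidable P → ∀ m → P m → ∃[ l ] P l × (∀ {j} → P j → l ≤ j)
least {P} P? = <-rec _ step
  where
  step : ∀ m → (∀ {j} → j < m → P j → ∃[ l ] P l × (∀ {j} → P j → l ≤ j)) →
         P m → ∃[ l ] P l × (∀ {j} → P j → l ≤ j)
  step m rec Pm with ℕ.anyUpTo? P? m
  ... | yes (j , j<m , Pj) = rec j<m Pj
  ... | no ¬smaller        = m , Pm , λ Pj → ℕ.≮⇒≥ λ j<m → ¬smaller (_ , j<m , Pj)

least-Fin : ∀ {n} {P : Fin n → Set} → Decidable P → ∃[ x ] P x →
            ∃[ x ] P x × (∀ {y} → P y → x Fin.≤ y)
least-Fin P? (x , Px)
  with least (λ m → Fin.any? λ y → (toℕ y ℕ.≟ m) ×-dec P? y) (toℕ x) (x , refl , Px)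
... | _ , (y , refl , Py) , min = y , Py , λ Pz → min (_ , refl , Pz)

-- Orbits of an injective self-map of a finite set

moved : ∀ {n} → (Fin n → Fin n) → List (Fin n)
moved σ = filter (λ x → ¬? (σ x Fin.≟ x)) (allFin _)

∈-moved⁺ : ∀ {n} (σ : Fin n → Fin n) {x} → σ x ≢ x → x ∈ moved σ
∈-moved⁺ σ = ∈-filter⁺ (λ x → ¬? (σ x Fin.≟ x)) (∈-allFin _)

∈-moved⁻ : ∀ {n} (σ : Fin n → Fin n) {x} → x ∈ moved σ → σ x ≢ x
∈-moved⁻ σ x∈ = proj₂ (∈-filter⁻ (λ x → ¬? (σ x Fin.≟ x)) {xs = allFin _} x∈)

moved-unique : ∀ {n} (σ : Fin n → Fin n) → List.Unique (moved σ)
moved-unique σ = Unique.filter⁺ (λ x → ¬? (σ x Fin.≟ x)) (Unique.allFin⁺ _)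

module Orbits {n} (σ : Fin n → Fin n) (σ-injective : Injective _≡_ _≡_ σ) where

  fold-injective : ∀ m {x y} → fold x σ m ≡ fold y σ m → x ≡ y
  fold-injective zero    eq = eq
  fold-injective (suc m) eq = fold-injective m (σ-injective eq)

  fold-comm : ∀ a b x → fold (fold x σ a) σ b ≡ fold (fold x σ b) σ a
  fold-comm a b x = begin
    fold (fold x σ a) σ b ≡⟨ fold-+ x σ b ⟨
    fold x σ (b + a)      ≡⟨ cong (fold x σ) (ℕ.+-comm b a) ⟩
    fold x σ (a + b)      ≡⟨ fold-+ x σ a ⟩
    fold (fold x σ b) σ a ∎
    where open ≡-Reasoning

  cancel : ∀ i d {x} → fold x σ i ≡ fold x σ (i + d) → fold x σ d ≡ x
  cancel i d {x} eq = sym (fold-injective i (trans eq (fold-+ x σ i)))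

  -- Two of the first `suc n` iterates coincide by pigeonhole, and injectivity cancels the steps
  -- that they share.
  returns : ∀ x → ∃[ l ] fold x σ (suc l) ≡ x
  returns x =
    let i , j , i<j , eq = Fin.pigeonhole (ℕ.n<1+n n) (λ (i : Fin (suc n)) → fold x σ (toℕ i))
        d , i+d≡j = ℕ.m≤n⇒∃[o]m+o≡n i<j
    in d , cancel (toℕ i) (suc d)
             (trans eq (cong (fold x σ) (sym (trans (ℕ.+-suc (toℕ i) d) i+d≡j))))

  -- Unfolding the search makes case analysis on the parity of a period intractable.
  abstract
    leastReturn : ∀ x → ∃[ l ] fold x σ (suc l) ≡ x × (∀ {j} → fold x σ (suc j) ≡ x → l ≤ j)
    leastReturn x =
      let l , eq = returns x in least (λ l → fold x σ (suc l) Fin.≟ x) l eq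

  -- The successor excludes the trivial return after no step, so a period is positive.
  period : Fin n → ℕ
  period x = suc (proj₁ (leastReturn x))

  fold-period : ∀ x → fold x σ (period x) ≡ x
  fold-period x = proj₁ (proj₂ (leastReturn x))

  period-least : ∀ {x m} → fold x σ (suc m) ≡ x → period x ≤ suc m
  period-least {x} eq = s≤s (proj₂ (proj₂ (leastReturn x)) eq)

  -- Iterates of `σ` commute and are injective, so a point and its iterates return after the same
  -- numbers of steps.
  period-fold : ∀ m x → period (fold x σ m) ≡ period x
  period-fold m x = ℕ.≤-antisym
    (period-least (trans (fold-comm m (period x) x) (cong (λ y → fold y σ m) (fold-period x))))
    (period-least (fold-injective m
      (trans (fold-comm (period (fold x σ m)) m x) (fold-period (fold x σ m)))))

  orbit-distinct : ∀ {x i j} → i < j → j < period x → fold x σ i ≢ fold x σ j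
  orbit-distinct {x} {i} {j} i<j j<p eq =
    let d , i+d≡j = ℕ.m≤n⇒∃[o]m+o≡n i<j
        i+sd≡j    = trans (ℕ.+-suc i d) i+d≡j
        p≤sd      = period-least (cancel i (suc d) (trans eq (cong (fold x σ) (sym i+sd≡j))))
    in ℕ.<⇒≱ j<p (ℕ.≤-trans p≤sd (ℕ.≤-trans (ℕ.m≤n+m (suc d) i) (ℕ.≤-reflexive i+sd≡j)))

  moved-fold : ∀ m {x} → σ x ≢ x → σ (fold x σ m) ≢ fold x σ m
  moved-fold m {x} σx≢x eq = σx≢x (fold-injective m (trans (fold-comm 1 m x) eq))

  -- A fixed-point-free involution of the points of even orbits, so these points are even in number.
  halfTurn : Fin n → Fin n
  halfTurn x = [ (λ (h , _) → fold x σ h) , (λ _ → x) ] (parity (period x))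

  halfTurn-even : ∀ {x h} → period x ≡ h + h → halfTurn x ≡ fold x σ h
  halfTurn-even {x} {h} eq with parity (period x)
  ... | inj₁ (h′ , eq′) = cong (fold x σ) (double-injective h′ h (trans (sym eq′) eq))
  ... | inj₂ (h′ , eq′) = contradiction (trans (sym eq) eq′) (double≢odd h h′)

  halfTurn-odd : ∀ {x} → Odd (period x) → halfTurn x ≡ x
  halfTurn-odd {x} (h , eq) with parity (period x)
  ... | inj₁ (h′ , eq′) = contradiction (trans (sym eq′) eq) (double≢odd h′ h)
  ... | inj₂ _          = refl

  halfTurn-involutive : ∀ x → halfTurn (halfTurn x) ≡ x
  halfTurn-involutive x with parity (period x)
  ... | inj₂ o        = halfTurn-odd o
  ... | inj₁ (h , eq) = begin
    halfTurn (fold x σ h) ≡⟨ halfTurn-even {h = h} (trans (period-fold h x) eq) ⟩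
    fold (fold x σ h) σ h ≡⟨ fold-+ x σ h ⟨
    fold x σ (h + h)      ≡⟨ cong (fold x σ) eq ⟨
    fold x σ (period x)   ≡⟨ fold-period x ⟩
    x                     ∎
    where open ≡-Reasoning

  -- If the period were even, a fixed point of the half turn would return after half of its period,
  -- against minimality.
  halfTurn-fixed⇒odd : ∀ {x} → halfTurn x ≡ x → Odd (period x)
  halfTurn-fixed⇒odd {x} eq with parity (period x)
  ... | inj₂ o              = o
  ... | inj₁ (zero , eq′)   = contradiction eq′ λ ()
  ... | inj₁ (suc h , eq′)  = contradiction (period-least eq)
    (ℕ.<⇒≱ (subst (suc h <_) (sym eq′) (s≤s (ℕ.≤-trans (ℕ.m≤n+m (suc h) h) ℕ.≤-refl))))

  -- Under the hypothesis `halfTurn` fixes no moved point. The moved points therefore split into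
  -- those that it raises and those that it lowers, and it exchanges the two sets.
  moved-even : (∀ {x} → σ x ≢ x → ¬ Odd (period x)) →
               ∃[ h ] length (moved σ) ≡ h + h
  moved-even allEven = length up ,
    trans (length-filter-⊎ (λ x → ¬? (σ x Fin.≟ x)) up? down? split up⇒moved down⇒moved
             Fin.<-asym (allFin n))
          (cong (λ l → length up + l) (sym up≡down))
    where
    up?   = λ x → x Fin.<? halfTurn x
    down? = λ x → halfTurn x Fin.<? x

    up down : List (Fin n)
    up   = filter up? (allFin n)
    down = filter down? (allFin n)

    turned⇒moved : ∀ {x} → halfTurn x ≢ x → σ x ≢ x
    turned⇒moved hx≢x σx≡x = hx≢x (halfTurn-odd (0 , ℕ.≤-antisym (period-least σx≡x) (s≤s z≤n)))

    up⇒moved : ∀ {x} → x Fin.< halfTurn x → σ x ≢ x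
    up⇒moved lt = turned⇒moved (Fin.<⇒≢ lt ∘ sym)

    down⇒moved : ∀ {x} → halfTurn x Fin.< x → σ x ≢ x
    down⇒moved lt = turned⇒moved (Fin.<⇒≢ lt)

    split : ∀ {x} → σ x ≢ x → x Fin.< halfTurn x ⊎ halfTurn x Fin.< x
    split {x} σx≢x with Fin.<-cmp x (halfTurn x)
    ... | tri< lt _ _ = inj₁ lt
    ... | tri≈ _ eq _ = contradiction (halfTurn-fixed⇒odd (sym eq)) (allEven σx≢x)
    ... | tri> _ _ gt = inj₂ gt

    up≡down : length up ≡ length down
    up≡down = matching⇒≡ (λ x y → halfTurn x ≡ y)
      (Unique.filter⁺ up? (Unique.allFin⁺ n)) (Unique.filter⁺ down? (Unique.allFin⁺ n))
      (λ {x} x∈ → halfTurn x ,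
        ∈-filter⁺ down? (∈-allFin _)
          (subst (Fin._< halfTurn x) (sym (halfTurn-involutive x))
            (proj₂ (∈-filter⁻ up? {xs = allFin n} x∈))) , refl)
      (λ {y} y∈ → halfTurn y ,
        ∈-filter⁺ up? (∈-allFin _)
          (subst (halfTurn y Fin.<_) (sym (halfTurn-involutive y))
            (proj₂ (∈-filter⁻ down? {xs = allFin n} y∈))) , halfTurn-involutive y)
      (λ _ _ eq eq′ → trans (sym (halfTurn-involutive _))
        (trans (cong halfTurn (trans eq (sym eq′))) (halfTurn-involutive _)))
      (λ _ _ eq eq′ → trans (sym eq) eq′)

  oddOrbit : Odd (length (moved σ)) → ∃[ x ] σ x ≢ x × Odd (period x)
  oddOrbit (h , eq) with Fin.any? (λ x → ¬? (σ x Fin.≟ x) ×-dec odd? (period x))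
  ... | yes found = found
  ... | no ¬found = let j , eq′ = moved-even (λ σx≢x o → ¬found (_ , σx≢x , o))
                    in contradiction (trans (sym eq′) eq) (double≢odd j h)

-- Reindexing the inversions of τ by τ shows that as many pairs i < j are inverted by both τ and
-- τ ∘ τ as are kept by τ and inverted by τ ∘ τ.
module _ {n} (τ ρ : Fin n → Fin n) (τρ : ∀ x → τ (ρ x) ≡ x) (ρτ : ∀ x → ρ (τ x) ≡ x) where

  private
    pairs : List (Fin n × Fin n)
    pairs = cartesianProduct (allFin n) (allFin n)

    pairs-unique : List.Unique pairs
    pairs-unique = Unique.cartesianProduct⁺ (Unique.allFin⁺ n) (Unique.allFin⁺ n)

    ∈-pairs : ∀ p → p ∈ pairs
    ∈-pairs (i , j) = ∈-cartesianProduct⁺ (∈-allFin i) (∈-allFin j)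

    τ-injective : Injective _≡_ _≡_ τ
    τ-injective eq = trans (sym (ρτ _)) (trans (cong ρ eq) (ρτ _))

    -- `Twisted` collects the pairs i < j whose image under `τ`, once put in increasing order, is
    -- `Inverted`. Its two alternatives record whether the sorting swaps the entries.
    Inverted InvertedTwice KeptThenInverted InvertedThenBack Twisted : Fin n × Fin n → Set
    Inverted         (i , j) = i Fin.< j × τ j Fin.< τ i
    InvertedTwice    (i , j) = i Fin.< j × τ j Fin.< τ i × τ (τ j) Fin.< τ (τ i)
    KeptThenInverted (i , j) = i Fin.< j × τ i Fin.< τ j × τ (τ j) Fin.< τ (τ i)
    InvertedThenBack (i , j) = i Fin.< j × τ j Fin.< τ i × τ (τ i) Fin.< τ (τ j)
    Twisted p                = KeptThenInverted p ⊎ InvertedThenBack p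

    inverted? : Decidable Inverted
    inverted? (i , j) = (i Fin.<? j) ×-dec (τ j Fin.<? τ i)

    invertedTwice? : Decidable InvertedTwice
    invertedTwice? (i , j) = (i Fin.<? j) ×-dec (τ j Fin.<? τ i) ×-dec (τ (τ j) Fin.<? τ (τ i))

    keptThenInverted? : Decidable KeptThenInverted
    keptThenInverted? (i , j) = (i Fin.<? j) ×-dec (τ i Fin.<? τ j) ×-dec (τ (τ j) Fin.<? τ (τ i))

    invertedThenBack? : Decidable InvertedThenBack
    invertedThenBack? (i , j) = (i Fin.<? j) ×-dec (τ j Fin.<? τ i) ×-dec (τ (τ i) Fin.<? τ (τ j))

    twisted? : Decidable Twisted
    twisted? p = keptThenInverted? p ⊎-dec invertedThenBack? p

    compare-τ : ∀ {i j} → i Fin.< j → τ i Fin.< τ j ⊎ τ j Fin.< τ i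
    compare-τ {i} {j} i<j with Fin.<-cmp (τ i) (τ j)
    ... | tri< lt _ _ = inj₁ lt
    ... | tri≈ _ eq _ = contradiction (τ-injective eq) (Fin.<⇒≢ i<j)
    ... | tri> _ _ gt = inj₂ gt

    -- Equality of unordered pairs, with `τ` applied to the first. Since both pairs are increasing
    -- where it is used, it is a bijective correspondence there.
    Image : Fin n × Fin n → Fin n × Fin n → Set
    Image (i , j) (a , b) = (τ i ≡ a × τ j ≡ b) ⊎ (τ i ≡ b × τ j ≡ a)

    image : ∀ {p} → Twisted p → ∃[ q ] Inverted q × Image p q
    image (inj₁ (_ , τi<τj , lt)) = _ , (τi<τj , lt) , inj₁ (refl , refl)
    image (inj₂ (_ , τj<τi , lt)) = _ , (τj<τi , lt) , inj₂ (refl , refl)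

    preimage : ∀ {q} → Inverted q → ∃[ p ] Twisted p × Image p q
    preimage {a , b} (a<b , lt) with Fin.<-cmp (ρ a) (ρ b)
    ... | tri≈ _ eq _ = contradiction (trans (sym (τρ a)) (trans (cong τ eq) (τρ b))) (Fin.<⇒≢ a<b)
    ... | tri< ρa<ρb _ _ =
      (ρ a , ρ b) , inj₁ (ρa<ρb , subst₂ Fin._<_ (sym (τρ a)) (sym (τρ b)) a<b
                               , subst₂ Fin._<_ (cong τ (sym (τρ b))) (cong τ (sym (τρ a))) lt)
                  , inj₁ (τρ a , τρ b)
    ... | tri> _ _ ρb<ρa =
      (ρ b , ρ a) , inj₂ (ρb<ρa , subst₂ Fin._<_ (sym (τρ a)) (sym (τρ b)) a<b
                               , subst₂ Fin._<_ (cong τ (sym (τρ b))) (cong τ (sym (τρ a))) lt)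
                  , inj₂ (τρ b , τρ a)

    ordered : ∀ {p} → Twisted p → proj₁ p Fin.< proj₂ p
    ordered (inj₁ (lt , _)) = lt
    ordered (inj₂ (lt , _)) = lt

    image-injective : ∀ {p p′ q} → Twisted p → Twisted p′ → Image p q → Image p′ q → p ≡ p′
    image-injective t t′ (inj₁ (e , f)) (inj₁ (e′ , f′)) =
      cong₂ _,_ (τ-injective (trans e (sym e′))) (τ-injective (trans f (sym f′)))
    image-injective t t′ (inj₂ (e , f)) (inj₂ (e′ , f′)) =
      cong₂ _,_ (τ-injective (trans e (sym e′))) (τ-injective (trans f (sym f′)))
    -- With opposite orientations `p′` would be `p` reversed, although both are increasing.
    image-injective t t′ (inj₁ (e , f)) (inj₂ (e′ , f′)) = contradiction (ordered t)
      (Fin.<-asym (subst₂ Fin._<_ (τ-injective (trans e′ (sym f)))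
        (τ-injective (trans f′ (sym e))) (ordered t′)))
    image-injective t t′ (inj₂ (e , f)) (inj₁ (e′ , f′)) = contradiction (ordered t)
      (Fin.<-asym (subst₂ Fin._<_ (τ-injective (trans e′ (sym f)))
        (τ-injective (trans f′ (sym e))) (ordered t′)))

    image-functional : ∀ {p q q′} → Inverted q → Inverted q′ → Image p q → Image p q′ → q ≡ q′
    image-functional _ _ (inj₁ (e , f)) (inj₁ (e′ , f′)) = cong₂ _,_ (trans (sym e) e′) (trans (sym f) f′)
    image-functional _ _ (inj₂ (e , f)) (inj₂ (e′ , f′)) = cong₂ _,_ (trans (sym f) f′) (trans (sym e) e′)
    image-functional (a<b , _) (a′<b′ , _) (inj₁ (e , f)) (inj₂ (e′ , f′)) = contradiction a<b
      (Fin.<-asym (subst₂ Fin._<_ (trans (sym f′) f) (trans (sym e′) e) a′<b′))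
    image-functional (a<b , _) (a′<b′ , _) (inj₂ (e , f)) (inj₁ (e′ , f′)) = contradiction a<b
      (Fin.<-asym (subst₂ Fin._<_ (trans (sym e′) e) (trans (sym f′) f) a′<b′))

    #twisted≡#inverted : length (filter twisted? pairs) ≡ length (filter inverted? pairs)
    #twisted≡#inverted = matching⇒≡ Image
      (Unique.filter⁺ twisted? pairs-unique) (Unique.filter⁺ inverted? pairs-unique)
      (λ p∈ → let q , Iq , im = image (twisted p∈) in q , ∈-filter⁺ inverted? (∈-pairs q) Iq , im)
      (λ q∈ → let p , Tp , im = preimage (inverted q∈) in p , ∈-filter⁺ twisted? (∈-pairs p) Tp , im)
      (λ p∈ p′∈ → image-injective (twisted p∈) (twisted p′∈))
      (λ q∈ q′∈ → image-functional (inverted q∈) (inverted q′∈))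
      where
      twisted : ∀ {p} → p ∈ filter twisted? pairs → Twisted p
      twisted = proj₂ ∘ ∈-filter⁻ twisted? {xs = pairs}
      inverted : ∀ {p} → p ∈ filter inverted? pairs → Inverted p
      inverted = proj₂ ∘ ∈-filter⁻ inverted? {xs = pairs}

    -- `Twisted` and `Inverted` are equinumerous and share the part `InvertedThenBack`; cancelling
    -- it leaves the two classes compared here.
    #kept≡#invertedTwice :
      length (filter keptThenInverted? pairs) ≡ length (filter invertedTwice? pairs)
    #kept≡#invertedTwice = ℕ.+-cancelʳ-≡ (length (filter invertedThenBack? pairs)) _ _ (begin
      length (filter keptThenInverted? pairs) + length (filter invertedThenBack? pairs)
        ≡⟨ length-filter-⊎ twisted? keptThenInverted? invertedThenBack? id inj₁ inj₂
             (λ (_ , lt , _) (_ , gt , _) → Fin.<-asym lt gt) pairs ⟨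
      length (filter twisted? pairs)
        ≡⟨ #twisted≡#inverted ⟩
      length (filter inverted? pairs)
        ≡⟨ length-filter-⊎ inverted? invertedTwice? invertedThenBack?
             (λ (i<j , lt) → [ (λ gt → inj₂ (i<j , lt , gt)) , (λ gt → inj₁ (i<j , lt , gt)) ]
                               (swap (compare-τ lt)))
             (λ (i<j , lt , _) → i<j , lt) (λ (i<j , lt , _) → i<j , lt)
             (λ (_ , _ , lt) (_ , _ , gt) → Fin.<-asym lt gt) pairs ⟩
      length (filter invertedTwice? pairs) + length (filter invertedThenBack? pairs) ∎)
      where open ≡-Reasoning

  -- An inversion of the square is either inverted by the first application of `τ` or kept by it,
  -- and the two kinds are equally many.
  inversions-square : (σ : Vec (Fin n) n) → (∀ x → lookup σ x ≡ τ (τ x)) →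
                      ∃[ h ] length (inversions σ) ≡ h + h
  inversions-square σ σ≗ττ = length (filter invertedTwice? pairs) , (begin
    length (inversions σ)
      ≡⟨ length-filter-⊎ (λ (i , j) → (i Fin.<? j) ×-dec (lookup σ j Fin.<? lookup σ i))
           invertedTwice? keptThenInverted? split
           (λ (i<j , _ , lt) → i<j , back lt) (λ (i<j , _ , lt) → i<j , back lt)
           (λ (_ , lt , _) (_ , gt , _) → Fin.<-asym lt gt) pairs ⟩
    length (filter invertedTwice? pairs) + length (filter keptThenInverted? pairs)
      ≡⟨ cong (λ l → length (filter invertedTwice? pairs) + l) #kept≡#invertedTwice ⟩
    length (filter invertedTwice? pairs) + length (filter invertedTwice? pairs) ∎)
    where
    open ≡-Reasoning

    back : ∀ {i j} → τ (τ j) Fin.< τ (τ i) → lookup σ j Fin.< lookup σ i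
    back = subst₂ Fin._<_ (sym (σ≗ττ _)) (sym (σ≗ττ _))

    split : ∀ {p} → proj₁ p Fin.< proj₂ p × lookup σ (proj₂ p) Fin.< lookup σ (proj₁ p) →
            InvertedTwice p ⊎ KeptThenInverted p
    split (i<j , lt) with compare-τ i<j
    ... | inj₁ kept     = inj₂ (i<j , kept , subst₂ Fin._<_ (σ≗ττ _) (σ≗ττ _) lt)
    ... | inj₂ inverted = inj₁ (i<j , inverted , subst₂ Fin._<_ (σ≗ττ _) (σ≗ττ _) lt)

-- The exponents q+1 and q add up to 2q+1, so the q-th iterate is the inverse of the square root;
-- doubling q+1 overshoots 2q+1 by a single application of `σ`.
inversions-oddOrder : ∀ {n} (σ : Vec (Fin n) n) q → (∀ x → fold x (lookup σ) (suc (q + q)) ≡ x) →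
                      ∃[ h ] length (inversions σ) ≡ h + h
inversions-oddOrder σ q σ-order = inversions-square (λ x → fold x s (suc q)) (λ x → fold x s q)
  (λ x → trans (sym (fold-+ x s (suc q))) (σ-order x))
  (λ x → trans (sym (fold-+ x s q)) (trans (cong (fold x s) (ℕ.+-suc q q)) (σ-order x)))
  σ (λ x → begin
    s x                                ≡⟨ cong s (σ-order x) ⟨
    fold x s (suc (suc (q + q)))       ≡⟨ cong (fold x s ∘ suc) (ℕ.+-suc q q) ⟨
    fold x s (suc q + suc q)           ≡⟨ fold-+ x s (suc q) ⟩
    fold (fold x s (suc q)) s (suc q)  ∎)
  where
  open ≡-Reasoning
  s = lookup σ

-- Cyclic words

next : ∀ {m} → Fin (suc m) → Fin (suc m)
next i with view i
... | ‵fromℕ     = zero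
... | ‵inject₁ j = suc j

next-fromℕ : ∀ m → next (fromℕ m) ≡ zero
next-fromℕ m rewrite view-fromℕ m = refl

next-inject₁ : ∀ {m} (j : Fin m) → next (inject₁ j) ≡ suc j
next-inject₁ j rewrite view-inject₁ j = refl

next-injective : ∀ {m} {i j : Fin (suc m)} → next i ≡ next j → i ≡ j
next-injective {i = i} {j} eq with view i | view j
... | ‵fromℕ     | ‵fromℕ     = refl
... | ‵inject₁ _ | ‵inject₁ _ = cong inject₁ (Fin.suc-injective eq)

next≢ : ∀ {m} (i : Fin (suc (suc m))) → next i ≢ i
next≢ i eq with view i
... | ‵inject₁ j = ℕ.1+n≢n (trans (cong toℕ eq) (Fin.toℕ-inject₁ j))

-- Negation modulo `suc m`: it reverses a cyclic word and keeps its root in place.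
neg : ∀ {m} → Fin (suc m) → Fin (suc m)
neg zero    = zero
neg (suc i) = suc (Fin.opposite i)

neg-involutive : ∀ {m} (i : Fin (suc m)) → neg (neg i) ≡ i
neg-involutive zero    = refl
neg-involutive (suc i) = cong suc (Fin.opposite-involutive i)

opposite-fromℕ : ∀ m → Fin.opposite (fromℕ m) ≡ zero
-- `Fin.opposite zero` computes to `fromℕ m`.
opposite-fromℕ m = Fin.opposite-involutive (zero {m})

opposite-inject₁ : ∀ {m} (i : Fin m) → Fin.opposite (inject₁ i) ≡ suc (Fin.opposite i)
opposite-inject₁ zero    = refl
opposite-inject₁ (suc i) = cong inject₁ (opposite-inject₁ i)

-- In residues this is 1 - (i + 1) = -i. It makes a step of the reversed word a step of the original
-- one, taken backwards.
next-neg-next : ∀ {m} (i : Fin (suc m)) → next (neg (next i)) ≡ neg i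
next-neg-next {zero}  zero = refl
next-neg-next {suc m} i with view i
... | ‵fromℕ           = cong suc (sym (opposite-fromℕ m))
... | ‵inject₁ zero    = next-fromℕ (suc m)
... | ‵inject₁ (suc j) = begin
  next (inject₁ (suc (Fin.opposite j))) ≡⟨ next-inject₁ (suc (Fin.opposite j)) ⟩
  suc (suc (Fin.opposite j))            ≡⟨ cong suc (opposite-inject₁ j) ⟨
  suc (Fin.opposite (inject₁ j))        ∎
  where open ≡-Reasoning

lookup-∷ʳ : ∀ {A : Set} {m} (v : A) (vs : Vec A m) i →
            lookup (vs ∷ʳ v) i ≡ lookup (v ∷ vs) (next i)
lookup-∷ʳ v vs i with view i
... | ‵fromℕ     = lookup-∷ʳ-fromℕ vs
  where
  lookup-∷ʳ-fromℕ : ∀ {m} (vs : Vec _ m) → lookup (vs ∷ʳ v) (fromℕ m) ≡ v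
  lookup-∷ʳ-fromℕ []       = refl
  lookup-∷ʳ-fromℕ (_ ∷ vs) = lookup-∷ʳ-fromℕ vs
... | ‵inject₁ j = lookup-∷ʳ-inject₁ vs j
  where
  lookup-∷ʳ-inject₁ : ∀ {m} (vs : Vec _ m) j → lookup (vs ∷ʳ v) (inject₁ j) ≡ lookup vs j
  lookup-∷ʳ-inject₁ (_ ∷ vs) zero    = refl
  lookup-∷ʳ-inject₁ (_ ∷ vs) (suc j) = lookup-∷ʳ-inject₁ vs j

last-lookup : ∀ {A : Set} {m} (vs : Vec A (suc m)) → last vs ≡ lookup vs (fromℕ m)
last-lookup (v ∷ [])     = refl
last-lookup (v ∷ w ∷ vs) = last-lookup (w ∷ vs)

lookup-ext : ∀ {A : Set} {m} {u u′ : Vec A m} → (∀ i → lookup u i ≡ lookup u′ i) → u ≡ u′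
lookup-ext {u = u} {u′} eq =
  trans (sym (Vec.tabulate∘lookup u)) (trans (Vec.tabulate-cong eq) (Vec.tabulate∘lookup u′))

module CyclicWords {W : Set} (G : WeightedSimpleGraph W) where
  open WeightedSimpleGraph G using (n; Adj; adj?; adj-sym)

  -- Each cycle has two rooted words, one for each direction.
  Rooted : ∀ {m} → Vec (Fin n) (suc m) → Set
  Rooted u = Unique u × (∀ i → Adj (lookup u i) (lookup u (next i))) ×
             (∀ i → lookup u zero Fin.< lookup u (suc i))

  rooted? : ∀ {m} → Decidable (Rooted {m})
  rooted? u = unique? u ×-dec Fin.all? (λ i → adj? (lookup u i) (lookup u (next i)))
                        ×-dec Fin.all? (λ i → lookup u zero Fin.<? lookup u (suc i))

  lookup-steps : ∀ {m} (u : Vec (Fin n) (suc m)) i →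
                 lookup (steps G u) i ≡ (lookup u i , lookup u (next i))
  lookup-steps (v ∷ vs) i =
    trans (Vec.lookup-zip i (v ∷ vs) (vs ∷ʳ v)) (cong (lookup (v ∷ vs) i ,_) (lookup-∷ʳ v vs i))

  -- The second and the last letter are the neighbours of the root, so their order is a direction.
  -- `Forward` is `IsCycle` rephrased by positions.
  Forward Backward : ∀ {m} → Vec (Fin n) (suc (suc m)) → Set
  Forward  {m} u = Rooted u × lookup u (suc zero) Fin.< lookup u (fromℕ (suc m))
  Backward {m} u = Rooted u × lookup u (fromℕ (suc m)) Fin.< lookup u (suc zero)

  backward? : ∀ {m} → Decidable (Backward {m})
  backward? {m} u = rooted? u ×-dec (lookup u (fromℕ (suc m)) Fin.<? lookup u (suc zero))

  cycle⇒forward : ∀ {m} {u : Vec (Fin n) (suc (suc m))} → IsCycle G u → Forward u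
  cycle⇒forward {u = u@(v ∷ v₁ ∷ vs)} (u! , adj , least , dir) =
    (u! , (λ i → subst (λ (x , y) → Adj x y) (lookup-steps u i) (All.lookup⁺ adj i))
        , All.lookup⁺ least)
    , subst (v₁ Fin.<_) (last-lookup (v₁ ∷ vs)) dir

  forward⇒cycle : ∀ {m} {u : Vec (Fin n) (suc (suc m))} → Forward u → IsCycle G u
  forward⇒cycle {u = u@(v ∷ v₁ ∷ vs)} ((u! , adj , least) , dir) =
    u! , All.lookup⁻ (λ i → subst (λ (x , y) → Adj x y) (sym (lookup-steps u i)) (adj i))
       , All.lookup⁻ least
       , subst (v₁ Fin.<_) (sym (last-lookup (v₁ ∷ vs))) dir

  reversal : ∀ {m} → Vec (Fin n) (suc m) → Vec (Fin n) (suc m)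
  reversal u = tabulate (lookup u ∘ neg)

  lookup-reversal : ∀ {m} (u : Vec (Fin n) (suc m)) i → lookup (reversal u) i ≡ lookup u (neg i)
  lookup-reversal u = Vec.lookup∘tabulate (lookup u ∘ neg)

  reversal-involutive : ∀ {m} (u : Vec (Fin n) (suc m)) → reversal (reversal u) ≡ u
  reversal-involutive u = lookup-ext λ i → begin
    lookup (reversal (reversal u)) i ≡⟨ lookup-reversal (reversal u) i ⟩
    lookup (reversal u) (neg i)      ≡⟨ lookup-reversal u (neg i) ⟩
    lookup u (neg (neg i))           ≡⟨ cong (lookup u) (neg-involutive i) ⟩
    lookup u i                       ∎
    where open ≡-Reasoning

  reversal-rooted : ∀ {m} {u : Vec (Fin n) (suc m)} → Rooted u → Rooted (reversal u)
  reversal-rooted {u = u} (u! , adj , least) =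
      VecUnique.tabulate⁺ (λ {i} {j} eq → trans (sym (neg-involutive i))
        (trans (cong neg (VecUnique.lookup-injective u! _ _ eq)) (neg-involutive j)))
    , (λ i → subst₂ Adj
        (trans (cong (lookup u) (next-neg-next i)) (sym (lookup-reversal u i)))
        (sym (lookup-reversal u (next i)))
        -- The edge leaving position -(i+1) leads to position -i; the reversed word runs along it
        -- the other way.
        (adj-sym (adj (neg (next i)))))
    , (λ i → subst (lookup u zero Fin.<_) (sym (lookup-reversal u (suc i))) (least (Fin.opposite i)))

  lookup-reversal-fromℕ : ∀ {m} (u : Vec (Fin n) (suc (suc m))) →
                          lookup (reversal u) (fromℕ (suc m)) ≡ lookup u (suc zero)
  lookup-reversal-fromℕ {m} u =
    trans (lookup-reversal u (fromℕ (suc m))) (cong (lookup u ∘ suc) (opposite-fromℕ m))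

  reversal-forward : ∀ {m} {u : Vec (Fin n) (suc (suc m))} → Forward u → Backward (reversal u)
  reversal-forward {u = u} (r , lt) = reversal-rooted r ,
    subst₂ Fin._<_ (sym (lookup-reversal-fromℕ u)) (sym (lookup-reversal u (suc zero))) lt

  reversal-backward : ∀ {m} {u : Vec (Fin n) (suc (suc m))} → Backward u → Forward (reversal u)
  reversal-backward {u = u} (r , lt) = reversal-rooted r ,
    subst₂ Fin._<_ (sym (lookup-reversal u (suc zero))) (sym (lookup-reversal-fromℕ u)) lt

  -- From length 3 on the root has two distinct neighbours; at length 2 the positions `suc zero` and
  -- `fromℕ` would coincide.
  direction : ∀ {m} {u : Vec (Fin n) (3 + m)} → Rooted u → Forward u ⊎ Backward u
  direction {m} {u} r@(u! , _) with Fin.<-cmp (lookup u (suc zero)) (lookup u (fromℕ (2 + m)))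
  ... | tri< lt _ _ = inj₁ (r , lt)
  ... | tri> _ _ gt = inj₂ (r , gt)
  ... | tri≈ _ eq _ with () ← VecUnique.lookup-injective u! (suc zero) (fromℕ (2 + m)) eq

  rooted⇒hasCycle : ∀ {m} {u : Vec (Fin n) (3 + m)} → Rooted u → HasCycle G (3 + m)
  rooted⇒hasCycle r with direction r
  ... | inj₁ f = _ , forward⇒cycle f
  ... | inj₂ b = _ , forward⇒cycle (reversal-backward b)

  -- The forward words are those listed by `cycles`, and reversal matches them with the backward
  -- ones.
  #rooted : ∀ m → length (filter rooted? (words n (3 + m))) ≡
                  length (cycles G (3 + m)) + length (cycles G (3 + m))
  #rooted m = trans
    (length-filter-⊎ rooted? (isCycle? G) backward?
      (λ r → [ inj₁ ∘ forward⇒cycle , inj₂ ] (direction r)) (proj₁ ∘ cycle⇒forward) proj₁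
      (λ cyc (_ , gt) → Fin.<-asym (proj₂ (cycle⇒forward cyc)) gt) ws)
    (cong (λ l → length (cycles G (3 + m)) + l) (sym #cycles≡#backward))
    where
    ws = words n (3 + m)

    #cycles≡#backward : length (cycles G (3 + m)) ≡ length (filter backward? ws)
    #cycles≡#backward = matching⇒≡ (λ u u′ → reversal u ≡ u′)
      (Unique.filter⁺ (isCycle? G) (words-unique n (3 + m)))
      (Unique.filter⁺ backward? (words-unique n (3 + m)))
      (λ u∈ → _ , ∈-filter⁺ backward? (words-complete _)
        (reversal-forward (cycle⇒forward (proj₂ (∈-filter⁻ (isCycle? G) {xs = ws} u∈)))) , refl)
      (λ u∈ → _ , ∈-filter⁺ (isCycle? G) (words-complete _)
        (forward⇒cycle (reversal-backward (proj₂ (∈-filter⁻ backward? {xs = ws} u∈))))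
        , reversal-involutive _)
      (λ _ _ eq eq′ → trans (sym (reversal-involutive _))
        (trans (cong reversal (trans eq (sym eq′))) (reversal-involutive _)))
      (λ _ _ eq eq′ → trans (sym eq) eq′)

-- Permutations moving the vertices of a single cycle

-- `σ` is the cyclic permutation along `u`. The pointwise form applies to `shift u` and to `lookup`
-- of a listed permutation alike.
Traces : ∀ {n m} → (Fin n → Fin n) → Vec (Fin n) (suc m) → Set
Traces σ u = (∀ i → σ (lookup u i) ≡ lookup u (next i)) ×
             (∀ {x} → (∀ i → lookup u i ≢ x) → σ x ≡ x)

shift : ∀ {n m} → Vec (Fin n) (suc m) → Fin n → Fin n
shift u x with Fin.any? (λ i → lookup u i Fin.≟ x)
... | yes (i , _) = lookup u (next i)
... | no _        = x

shift-traces : ∀ {n m} {u : Vec (Fin n) (suc m)} → Unique u → Traces (shift u) u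
shift-traces {u = u} u! = onCycle , offCycle
  where
  onCycle : ∀ i → shift u (lookup u i) ≡ lookup u (next i)
  onCycle i with Fin.any? (λ j → lookup u j Fin.≟ lookup u i)
  ... | yes (j , eq) = cong (lookup u ∘ next) (VecUnique.lookup-injective u! j i eq)
  ... | no ¬found    = contradiction (i , refl) ¬found

  offCycle : ∀ {x} → (∀ i → lookup u i ≢ x) → shift u x ≡ x
  offCycle {x} x∉u with Fin.any? (λ j → lookup u j Fin.≟ x)
  ... | yes (j , eq) = contradiction eq (x∉u j)
  ... | no _         = refl

module _ {n m} (u : Vec (Fin n) (suc m)) where

  occurs? : ∀ x → (∃[ i ] lookup u i ≡ x) ⊎ (∀ i → lookup u i ≢ x)
  occurs? x with Fin.any? (λ i → lookup u i Fin.≟ x)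
  ... | yes found = inj₁ found
  ... | no ¬found = inj₂ λ i eq → ¬found (i , eq)

  traces-cong : ∀ {σ τ : Fin n → Fin n} → (∀ x → σ x ≡ τ x) → Traces σ u → Traces τ u
  traces-cong σ≗τ (on , off) =
    (λ i → trans (sym (σ≗τ _)) (on i)) , (λ x∉u → trans (sym (σ≗τ _)) (off x∉u))

  traces-unique : ∀ {σ τ : Fin n → Fin n} → Traces σ u → Traces τ u → ∀ x → σ x ≡ τ x
  traces-unique (on , off) (on′ , off′) x with occurs? x
  ... | inj₁ (i , refl) = trans (on i) (sym (on′ i))
  ... | inj₂ x∉u        = trans (off x∉u) (sym (off′ x∉u))

  traces-moved⇒occurs : ∀ {σ : Fin n → Fin n} → Traces σ u → ∀ {x} → σ x ≢ x → ∃[ i ] lookup u i ≡ x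
  traces-moved⇒occurs (_ , off) {x} σx≢x with occurs? x
  ... | inj₁ found = found
  ... | inj₂ x∉u   = contradiction (off x∉u) σx≢x

  traces-injective : ∀ {σ : Fin n → Fin n} → Unique u → Traces σ u → Injective _≡_ _≡_ σ
  traces-injective {σ} u! (on , off) {x} {y} eq with occurs? x | occurs? y
  ... | inj₁ (i , refl) | inj₁ (j , refl) = cong (lookup u) (next-injective
        (VecUnique.lookup-injective u! _ _ (trans (sym (on i)) (trans eq (on j)))))
  ... | inj₁ (i , refl) | inj₂ y∉u = contradiction (trans (sym (on i)) (trans eq (off y∉u))) (y∉u _)
  ... | inj₂ x∉u | inj₁ (j , refl) = contradiction (trans (sym (on j)) (trans (sym eq) (off x∉u))) (x∉u _)
  ... | inj₂ x∉u | inj₂ y∉u        = trans (sym (off x∉u)) (trans eq (off y∉u))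

module _ {n m} {u : Vec (Fin n) (suc (suc m))} (u! : Unique u) {σ : Fin n → Fin n} where

  traces-occurs⇒moved : Traces σ u → ∀ i → σ (lookup u i) ≢ lookup u i
  traces-occurs⇒moved (on , _) i eq =
    next≢ i (VecUnique.lookup-injective u! _ _ (trans (sym (on i)) eq))

  traces-#moved : Traces σ u → length (moved σ) ≡ suc (suc m)
  traces-#moved t = trans
    (matching⇒≡ (λ x i → lookup u i ≡ x) (moved-unique σ) (Unique.allFin⁺ _)
      (λ x∈ → let i , eq = traces-moved⇒occurs u t (∈-moved⁻ σ x∈) in i , ∈-allFin i , eq)
      (λ {i} _ → lookup u i , ∈-moved⁺ σ (traces-occurs⇒moved t i) , refl)
      (λ _ _ eq eq′ → trans (sym eq) eq′)
      (λ _ _ eq eq′ → VecUnique.lookup-injective u! _ _ (trans eq (sym eq′))))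
    (List.length-tabulate id)

module CyclicPermutations {W : Set} (G : WeightedSimpleGraph W) where
  open WeightedSimpleGraph G using (n; Adj; adj?)
  open CyclicWords G

  -- The condition under which the product of entries picked by `σ` has a nonzero coefficient at the
  -- power n - k: each of the n - k fixed points supplies a factor λ, each moved point a factor -1.
  Contributes : ℕ → (Fin n → Fin n) → Set
  Contributes k σ = length (moved σ) ≡ k × (∀ x → σ x ≢ x → Adj x (σ x))

  contributes? : ∀ k → Decidable (Contributes k)
  contributes? k σ = (length (moved σ) ℕ.≟ k) ×-dec
    Fin.all? λ x → ¬? (σ x Fin.≟ x) →-dec adj? x (σ x)

  traces-contributes : ∀ {m σ} {u : Vec (Fin n) (suc (suc m))} →
                       Rooted u → Traces σ u → Contributes (suc (suc m)) σ
  traces-contributes {σ = σ} {u} (u! , adj , _) t = traces-#moved u! t , edges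
    where
    edges : ∀ x → σ x ≢ x → Adj x (σ x)
    edges x σx≢x with traces-moved⇒occurs u t σx≢x
    ... | i , refl = subst (Adj _) (sym (proj₁ t i)) (adj i)

  rooted-least : ∀ {m} {u : Vec (Fin n) (suc m)} → Rooted u → ∀ i → lookup u zero Fin.≤ lookup u i
  rooted-least r               zero    = ℕ.≤-refl
  rooted-least (_ , _ , least) (suc i) = ℕ.<⇒≤ (least i)

  -- The letters of either word are exactly the moved points, so the root is the least moved point;
  -- iterating `σ` from it determines the remaining letters.
  traces-rooted-unique : ∀ {m σ} {u u′ : Vec (Fin n) (suc (suc m))} →
    Rooted u → Rooted u′ → Traces σ u → Traces σ u′ → u ≡ u′
  traces-rooted-unique {σ = σ} {u} {u′} r r′ t t′ = lookup-ext
    (<-weakInduction (λ i → lookup u i ≡ lookup u′ i)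
      (Fin.≤-antisym (root≤ r r′ t t′) (root≤ r′ r t′ t))
      (λ i eq → trans (sym (step u t i)) (trans (cong σ eq) (step u′ t′ i))))
    where
    step : ∀ (v : Vec (Fin n) _) → Traces σ v → ∀ i → σ (lookup v (inject₁ i)) ≡ lookup v (suc i)
    step v (on , _) i = trans (on (inject₁ i)) (cong (lookup v) (next-inject₁ i))

    root≤ : ∀ {v v′ : Vec (Fin n) _} → Rooted v → Rooted v′ → Traces σ v → Traces σ v′ →
            lookup v zero Fin.≤ lookup v′ zero
    root≤ {v} r r′ t t′ with traces-moved⇒occurs v t (traces-occurs⇒moved (proj₁ r′) t′ zero)
    ... | i , eq = subst (lookup v zero Fin.≤_) eq (rooted-least r i)

  NoOddCycleBelow : ℕ → Set
  NoOddCycleBelow k = ∀ l → Odd l → l < k → ¬ HasCycle G l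

  module _ (σ : Fin n → Fin n) (σ-injective : Injective _≡_ _≡_ σ) where
    open Orbits σ σ-injective

    orbit : ∀ l → Fin n → Vec (Fin n) (suc l)
    orbit l x = tabulate (λ i → fold x σ (toℕ i))

    lookup-orbit : ∀ l x i → lookup (orbit l x) i ≡ fold x σ (toℕ i)
    lookup-orbit l x = Vec.lookup∘tabulate (λ i → fold x σ (toℕ i))

    fold-toℕ-injective : ∀ {l x} → period x ≡ l →
                         Injective _≡_ _≡_ (λ (i : Fin l) → fold x σ (toℕ i))
    fold-toℕ-injective refl {i} {j} eq with Fin.<-cmp i j
    ... | tri< lt _ _ = contradiction eq (orbit-distinct lt (Fin.toℕ<n j))
    ... | tri≈ _ i≡j _ = i≡j
    ... | tri> _ _ gt = contradiction (sym eq) (orbit-distinct gt (Fin.toℕ<n i))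

    orbit-step : ∀ {l x} → period x ≡ suc l → ∀ i → σ (lookup (orbit l x) i) ≡ lookup (orbit l x) (next i)
    orbit-step {l} {x} p i with view i
    ... | ‵fromℕ = begin
      σ (lookup (orbit l x) (fromℕ l)) ≡⟨ cong σ (lookup-orbit l x (fromℕ l)) ⟩
      fold x σ (suc (toℕ (fromℕ l)))   ≡⟨ cong (fold x σ ∘ suc) (Fin.toℕ-fromℕ l) ⟩
      fold x σ (suc l)                 ≡⟨ cong (fold x σ) p ⟨
      fold x σ (period x)              ≡⟨ fold-period x ⟩
      x                                ∎
      where open ≡-Reasoning
    ... | ‵inject₁ j = begin
      σ (lookup (orbit l x) (inject₁ j)) ≡⟨ cong σ (lookup-orbit l x (inject₁ j)) ⟩
      fold x σ (suc (toℕ (inject₁ j)))   ≡⟨ cong (fold x σ ∘ suc) (Fin.toℕ-inject₁ j) ⟩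
      fold x σ (toℕ (suc j))             ≡⟨ lookup-orbit l x (suc j) ⟨
      lookup (orbit l x) (suc j)         ∎
      where open ≡-Reasoning

    orbit-rooted : ∀ {l x} → period x ≡ suc l → σ x ≢ x → (∀ y → σ y ≢ y → Adj y (σ y)) →
                   (∀ m → x Fin.≤ fold x σ m) → Rooted (orbit l x)
    orbit-rooted {l} {x} p σx≢x edges least =
        VecUnique.tabulate⁺ (fold-toℕ-injective p)
      , (λ i → subst (Adj _) (orbit-step p i) (edges _
          (subst (λ y → σ y ≢ y) (sym (lookup-orbit l x i)) (moved-fold (toℕ i) σx≢x))))
      , (λ i → subst (x Fin.<_) (sym (lookup-orbit l x (suc i)))
          (Fin.≤∧≢⇒< (least (toℕ (suc i)))
            (λ eq → contradiction (fold-toℕ-injective p {zero} {suc i} eq) λ ())))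

    -- An odd orbit of moved vertices is an odd cycle, hence by minimality of k it exhausts the
    -- k moved vertices.
    contributes⇒traces : ∀ {m} → Odd (3 + m) → NoOddCycleBelow (3 + m) → Contributes (3 + m) σ →
      (∃[ u ] Rooted {2 + m} u × Traces σ u) × (∀ x → fold x σ (3 + m) ≡ x)
    contributes⇒traces {m} k-odd noShorter (#moved , edges)
      with least-Fin (λ x → ¬? (σ x Fin.≟ x) ×-dec odd? (period x))
             (oddOrbit (subst Odd (sym #moved) k-odd))
    ... | x , (σx≢x , p-odd) , x-least = (orbit (2 + m) x , rooted p≡k , orbit-step p≡k , fixed) , order
      where
      rooted : ∀ {l} → period x ≡ suc l → Rooted (orbit l x)
      -- `x` is least among all moved points of odd period, and its iterates are such points, so it
      -- is least in its own orbit.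
      rooted p = orbit-rooted p σx≢x edges λ j →
        x-least (moved-fold j σx≢x , subst Odd (sym (period-fold j x)) p-odd)

      x-returns : ∀ {l} → period x ≡ l → fold x σ l ≡ x
      x-returns refl = fold-period x

      p≮k : ∀ l → period x ≡ l → 3 + m ≤ l
      -- Periods below 3 are not cycle lengths and are excluded by hand: 0 by positivity, 1 because
      -- `x` is moved, 2 by parity.
      p≮k zero p = contradiction p λ ()
      p≮k 1    p = contradiction (x-returns p) σx≢x
      p≮k 2    p = contradiction (trans (sym p) (proj₂ p-odd)) (double≢odd 1 (proj₁ p-odd))
      p≮k (suc (suc (suc l))) p = ℕ.≮⇒≥ λ lt →
        noShorter (3 + l) (subst Odd p p-odd) lt (rooted⇒hasCycle (rooted p))

      p≡k : period x ≡ 3 + m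
      p≡k = ℕ.≤-antisym
        -- The orbit consists of `period x` distinct moved points, and there are only 3 + m of them.
        (subst (period x ≤_) #moved (embedding⇒≤ (λ i → fold x σ (toℕ i)) (fold-toℕ-injective refl)
          (λ i → ∈-moved⁺ σ (moved-fold (toℕ i) σx≢x))))
        (p≮k (period x) refl)

      inOrbit : ∀ {y} → σ y ≢ y → ∃[ i ] fold x σ (toℕ i) ≡ y
      inOrbit σy≢y = embedding-surjective (λ i → fold x σ (toℕ i)) (fold-toℕ-injective p≡k)
        (λ i → ∈-moved⁺ σ (moved-fold (toℕ i) σx≢x)) #moved (∈-moved⁺ σ σy≢y)

      fixed : ∀ {y} → (∀ i → lookup (orbit (2 + m) x) i ≢ y) → σ y ≡ y
      fixed {y} y∉ = decidable-stable (σ y Fin.≟ y) λ σy≢y →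
        let i , eq = inOrbit σy≢y in y∉ i (trans (lookup-orbit (2 + m) x i) eq)

      fold-fixed : ∀ j {y} → σ y ≡ y → fold y σ j ≡ y
      fold-fixed zero    eq = refl
      fold-fixed (suc j) eq = trans (cong σ (fold-fixed j eq)) eq

      order : ∀ y → fold y σ (3 + m) ≡ y
      order y with σ y Fin.≟ y
      ... | yes σy≡y = fold-fixed (3 + m) σy≡y
      ... | no σy≢y with inOrbit σy≢y
      ...   | i , refl = trans (fold-comm (toℕ i) (3 + m) x)
                               (cong (λ y → fold y σ (toℕ i)) (x-returns p≡k))

  #contributing : ∀ m → Odd (3 + m) → NoOddCycleBelow (3 + m) →
    length (filter (λ σ → contributes? (3 + m) (lookup σ)) (permutations n)) ≡
    length (cycles G (3 + m)) + length (cycles G (3 + m))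
  #contributing m k-odd noShorter = trans
    (matching⇒≡ (λ σ u → Traces (lookup σ) u)
      (Unique.filter⁺ good? (Unique.filter⁺ unique? (words-unique n n)))
      (Unique.filter⁺ rooted? (words-unique n (3 + m)))
      (λ σ∈ → let σ∈ₚ , good = ∈-filter⁻ good? {xs = permutations n} σ∈
                  σ! = proj₂ (∈-filter⁻ unique? {xs = words n n} σ∈ₚ)
                  (u , r , t) , _ = contributes⇒traces _ (VecUnique.lookup-injective σ! _ _)
                                      k-odd noShorter good
              in u , ∈-filter⁺ rooted? (words-complete u) r , t)
      (λ {u} u∈ → let r = proj₂ (∈-filter⁻ rooted? {xs = ws} u∈)
                      s = shift-traces (proj₁ r)
                      σ = tabulate (shift u)
                      t = traces-cong u (λ x → sym (Vec.lookup∘tabulate (shift u) x)) s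
                  in σ , ∈-filter⁺ good?
                           (∈-filter⁺ unique? (words-complete σ)
                             (VecUnique.tabulate⁺ (traces-injective u (proj₁ r) s)))
                           (traces-contributes r t) , t)
      (λ {_} {_} {u} _ _ t t′ → lookup-ext (traces-unique u t t′))
      (λ u∈ u′∈ → traces-rooted-unique (proj₂ (∈-filter⁻ rooted? {xs = ws} u∈))
                                        (proj₂ (∈-filter⁻ rooted? {xs = ws} u′∈))))
    (#rooted m)
    where
    good? : Decidable (λ (σ : Vec (Fin n) n) → Contributes (3 + m) (lookup σ))
    good? σ = contributes? (3 + m) (lookup σ)

    ws = words n (3 + m)

-- Coefficients of determinants over ℤ[X]

ℤ[X] : RawRing _ _
ℤ[X] = ℤ-ring [X]

coeff-⊕ : ∀ p q i → coeff ℤ-ring (_⊕_ ℤ-ring p q) i ≡ coeff ℤ-ring p i ℤ.+ coeff ℤ-ring q i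
coeff-⊕ []      q       i       = sym (ℤ.+-identityˡ _)
coeff-⊕ (a ∷ p) []      i       = sym (ℤ.+-identityʳ _)
coeff-⊕ (a ∷ p) (b ∷ q) zero    = refl
coeff-⊕ (a ∷ p) (b ∷ q) (suc i) = coeff-⊕ p q i

coeff-scale : ∀ a p i → coeff ℤ-ring (map (a ℤ.*_) p) i ≡ a ℤ.* coeff ℤ-ring p i
coeff-scale a []      i       = sym (ℤ.*-zeroʳ a)
coeff-scale a (b ∷ p) zero    = refl
coeff-scale a (b ∷ p) (suc i) = coeff-scale a p i

-- The product leaves a summand `ℤ.0ℤ ∷ []`, so the comparison is made on coefficients and not on
-- lists.
coeff-const-⊛ : ∀ a p i → coeff ℤ-ring (_⊛_ ℤ-ring (a ∷ []) p) i ≡ a ℤ.* coeff ℤ-ring p i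
coeff-const-⊛ a p i = begin
  coeff ℤ-ring (_⊛_ ℤ-ring (a ∷ []) p) i
    ≡⟨ coeff-⊕ (map (a ℤ.*_) p) (ℤ.0ℤ ∷ []) i ⟩
  coeff ℤ-ring (map (a ℤ.*_) p) i ℤ.+ coeff ℤ-ring (ℤ.0ℤ ∷ []) i
    ≡⟨ cong₂ ℤ._+_ (coeff-scale a p i) (coeff-zero i) ⟩
  a ℤ.* coeff ℤ-ring p i ℤ.+ ℤ.0ℤ
    ≡⟨ ℤ.+-identityʳ _ ⟩
  a ℤ.* coeff ℤ-ring p i ∎
  where
  open ≡-Reasoning
  coeff-zero : ∀ i → coeff ℤ-ring (ℤ.0ℤ ∷ []) i ≡ ℤ.0ℤ
  coeff-zero zero    = refl
  coeff-zero (suc i) = refl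

shiftCoeff : List ℤ → ℕ → ℤ
shiftCoeff p zero    = ℤ.0ℤ
shiftCoeff p (suc i) = coeff ℤ-ring p i

coeff-X-⊛ : ∀ p i → coeff ℤ-ring (_⊛_ ℤ-ring (indeterminate ℤ-ring) p) i ≡ shiftCoeff p i
coeff-X-⊛ p i = begin
  coeff ℤ-ring (_⊛_ ℤ-ring (indeterminate ℤ-ring) p) i
    ≡⟨ coeff-⊕ (map (ℤ.0ℤ ℤ.*_) p) (ℤ.0ℤ ∷ _⊛_ ℤ-ring (ℤ.1ℤ ∷ []) p) i ⟩
  coeff ℤ-ring (map (ℤ.0ℤ ℤ.*_) p) i ℤ.+ coeff ℤ-ring (ℤ.0ℤ ∷ _⊛_ ℤ-ring (ℤ.1ℤ ∷ []) p) i
    ≡⟨ cong₂ ℤ._+_ (trans (coeff-scale ℤ.0ℤ p i) (ℤ.*-zeroˡ (coeff ℤ-ring p i))) (shifted i) ⟩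
  ℤ.0ℤ ℤ.+ shiftCoeff p i
    ≡⟨ ℤ.+-identityˡ _ ⟩
  shiftCoeff p i ∎
  where
  open ≡-Reasoning
  shifted : ∀ i → coeff ℤ-ring (ℤ.0ℤ ∷ _⊛_ ℤ-ring (ℤ.1ℤ ∷ []) p) i ≡ shiftCoeff p i
  shifted zero    = refl
  shifted (suc i) = trans (coeff-const-⊛ ℤ.1ℤ p i) (ℤ.*-identityˡ _)

-- Membership is handed to `yes-case` because the sign of a contributing term is computed from the
-- injectivity of a listed permutation.
sum-indicator : ∀ {A : Set} {P : A → Set} (P? : Decidable P) (f : A → List ℤ) (a : ℤ) i xs →
  (∀ {x} → x ∈ xs → P x → coeff ℤ-ring (f x) i ≡ a) →
  (∀ {x} → ¬ P x → coeff ℤ-ring (f x) i ≡ ℤ.0ℤ) →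
  coeff ℤ-ring (sum ℤ[X] (map f xs)) i ≡ + length (filter P? xs) ℤ.* a
sum-indicator P? f a i []       yes-case no-case = sym (ℤ.*-zeroˡ a)
sum-indicator P? f a i (x ∷ xs) yes-case no-case
  with ih ← sum-indicator P? f a i xs (yes-case ∘ there) no-case
     | eq ← coeff-⊕ (f x) (sum ℤ[X] (map f xs)) i
     | P? x
... | yes Px = trans eq (trans (cong₂ ℤ._+_ (yes-case (here refl) Px) ih)
                               (sym (ℤ.suc-* (+ length (filter P? xs)) a)))
... | no ¬Px = trans eq (trans (cong₂ ℤ._+_ (no-case ¬Px) ih) (ℤ.+-identityˡ _))

-- A product of factors λ, -1 and 0 is zero or a signed monomial whose degree counts the factors λ.
-- In the application `P` marks the moved points and `Q` those sent along an edge.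
module _ {A : Set} {P Q : A → Set} (P? : Decidable P) (f : A → List ℤ)
  (indeterminate-factor : ∀ {x} → ¬ P x → f x ≡ indeterminate ℤ-ring)
  (edge-factor : ∀ {x} → P x → Q x → f x ≡ ℤ.-1ℤ ∷ [])
  (zero-factor : ∀ {x} → P x → ¬ Q x → f x ≡ ℤ.0ℤ ∷ [])
  (Q? : Decidable Q)
  where

  private
    Π : List A → List ℤ
    Π xs = product ℤ[X] (map f xs)

  coeff-product : ∀ xs m → m + length (filter P? xs) ≡ length xs →
    (∀ {x} → x ∈ xs → P x → Q x) →
    coeff ℤ-ring (Π xs) m ≡ ℤ.-1ℤ ℤ.^ length (filter P? xs)
  coeff-product []       zero eq all = refl
  coeff-product (x ∷ xs) m    eq all with P? x
  ... | yes Px rewrite edge-factor Px (all (here refl) Px) =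
    trans (coeff-const-⊛ ℤ.-1ℤ (Π xs) m) (cong (ℤ.-1ℤ ℤ.*_)
      (coeff-product xs m (ℕ.suc-injective (trans (sym (ℕ.+-suc m _)) eq)) (all ∘ there)))
  -- Exponent zero would put every entry of the list in `P`, yet `x` is not.
  coeff-product (x ∷ xs) zero eq all | no ¬Px =
    contradiction (List.length-filter P? xs) (ℕ.<⇒≱ (ℕ.≤-reflexive (sym eq)))
  coeff-product (x ∷ xs) (suc m) eq all | no ¬Px rewrite indeterminate-factor ¬Px =
    trans (coeff-X-⊛ (Π xs) (suc m)) (coeff-product xs m (ℕ.suc-injective eq) (all ∘ there))

  -- Starting from a nonzero coefficient lets the induction strip one factor at a time, the shorter
  -- product keeping a nonzero coefficient. `Π-vanishes` uses the contrapositive, integer equality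
  -- being decidable.
  coeff-product≢0 : ∀ xs m → coeff ℤ-ring (Π xs) m ≢ ℤ.0ℤ →
    m + length (filter P? xs) ≡ length xs × (∀ {x} → x ∈ xs → P x → Q x)
  coeff-product≢0 []       zero    ≢0 = refl , λ ()
  coeff-product≢0 []       (suc m) ≢0 = contradiction refl ≢0
  coeff-product≢0 (x ∷ xs) m       ≢0 with P? x
  coeff-product≢0 (x ∷ xs) zero    ≢0 | no ¬Px rewrite indeterminate-factor ¬Px =
    contradiction (coeff-X-⊛ (Π xs) zero) ≢0
  coeff-product≢0 (x ∷ xs) (suc m) ≢0 | no ¬Px rewrite indeterminate-factor ¬Px =
    let eq , all = coeff-product≢0 xs m (≢0 ∘ trans (coeff-X-⊛ (Π xs) (suc m)))
    in cong suc eq , λ { (here refl) Px → contradiction Px ¬Px ; (there x∈) → all x∈ }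
  ... | yes Px with Q? x
  ...   | no ¬Qx rewrite zero-factor Px ¬Qx =
    contradiction (trans (coeff-const-⊛ ℤ.0ℤ (Π xs) m) (ℤ.*-zeroˡ (coeff ℤ-ring (Π xs) m))) ≢0
  ...   | yes Qx rewrite edge-factor Px Qx =
    let eq , all = coeff-product≢0 xs m λ ≡0 → ≢0
          (trans (coeff-const-⊛ ℤ.-1ℤ (Π xs) m) (trans (cong (ℤ.-1ℤ ℤ.*_) ≡0) (ℤ.*-zeroʳ ℤ.-1ℤ)))
    in trans (ℕ.+-suc m _) (cong suc eq) , λ { (here refl) _ → Qx ; (there x∈) → all x∈ }

-1^odd : ∀ {k} → Odd k → ℤ.-1ℤ ℤ.^ k ≡ ℤ.-1ℤ
-1^odd (h , refl) = cong (ℤ.-1ℤ ℤ.*_) (begin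
  ℤ.-1ℤ ℤ.^ (h + h)                ≡⟨ ℤ.^-distribˡ-+-* ℤ.-1ℤ h h ⟩
  ℤ.-1ℤ ℤ.^ h ℤ.* ℤ.-1ℤ ℤ.^ h      ≡⟨ square h ⟩
  ℤ.1ℤ                             ∎)
  where
  open ≡-Reasoning
  square : ∀ h → ℤ.-1ℤ ℤ.^ h ℤ.* ℤ.-1ℤ ℤ.^ h ≡ ℤ.1ℤ
  square zero    = refl
  square (suc h) with ℤ.-1ℤ ℤ.^ h | square h
  ... | a | a²≡1 = begin
    ℤ.-1ℤ ℤ.* a ℤ.* (ℤ.-1ℤ ℤ.* a) ≡⟨ cong₂ ℤ._*_ (ℤ.-1*i≡-i a) (ℤ.-1*i≡-i a) ⟩
    ℤ.- a ℤ.* ℤ.- a               ≡⟨ ℤ.neg-distribˡ-* a (ℤ.- a) ⟨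
    ℤ.- (a ℤ.* ℤ.- a)             ≡⟨ cong (λ b → ℤ.- b) (ℤ.neg-distribʳ-* a a) ⟨
    ℤ.- ℤ.- (a ℤ.* a)             ≡⟨ ℤ.neg-involutive _ ⟩
    a ℤ.* a                       ≡⟨ a²≡1 ⟩
    ℤ.1ℤ                          ∎

-- A constant factor of any value preserves a zero coefficient, which settles the terms that do not
-- contribute.
sign-constant : ∀ {n} (σ : Vec (Fin n) n) → ∃[ s ] sign ℤ[X] σ ≡ s ∷ []
sign-constant σ = go (inversions σ)
  where
  go : ∀ {A : Set} (xs : List A) →
       ∃[ s ] List.foldr (λ _ → RawRing.-_ ℤ[X]) (ℤ.1ℤ ∷ []) xs ≡ s ∷ []
  go []       = ℤ.1ℤ , refl
  go (_ ∷ xs) = let s , eq = go xs in ℤ.- s , cong (RawRing.-_ ℤ[X]) eq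

sign-even : ∀ {n} (σ : Vec (Fin n) n) → ∃[ h ] length (inversions σ) ≡ h + h →
            sign ℤ[X] σ ≡ ℤ.1ℤ ∷ []
sign-even σ (h , eq) = go (inversions σ) h eq
  where
  go : ∀ {A : Set} (xs : List A) h → length xs ≡ h + h →
       List.foldr (λ _ → RawRing.-_ ℤ[X]) (ℤ.1ℤ ∷ []) xs ≡ ℤ.1ℤ ∷ []
  go []           h       _  = refl
  go (_ ∷ [])     h       eq = contradiction (sym eq) (double≢odd h 0)
  go (_ ∷ _ ∷ xs) (suc h) eq =
    cong (RawRing.-_ ℤ[X] ∘ RawRing.-_ ℤ[X])
      (go xs h (ℕ.suc-injective (ℕ.suc-injective (trans eq (cong suc (ℕ.+-suc h h))))))

module CharacteristicPolynomial {W : Set} (G : WeightedSimpleGraph W) where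
  open WeightedSimpleGraph G using (n; Adj; adj?; adj-irrefl)
  open CyclicPermutations G

  private
    A : Matrix ℤ n
    A = adjacency G

    entry : Fin n → Fin n → List ℤ
    entry i j = _⊕_ ℤ-ring (if does (i Fin.≟ j) then indeterminate ℤ-ring else [])
                           (RawRing.-_ ℤ[X] (const ℤ-ring (A i j)))

    adjacency-adj : ∀ {i j} → Adj i j → A i j ≡ ℤ.1ℤ
    adjacency-adj {i} {j} a rewrite dec-true (adj? i j) a = refl

    adjacency-nonadj : ∀ {i j} → ¬ Adj i j → A i j ≡ ℤ.0ℤ
    adjacency-nonadj {i} {j} ¬a rewrite dec-false (adj? i j) ¬a = refl

    -- The graph has no loops, so a fixed point supplies λ with no constant term.
    entry-diagonal : ∀ {i j} → j ≡ i → entry i j ≡ indeterminate ℤ-ring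
    entry-diagonal {i} refl
      rewrite dec-true (i Fin.≟ i) refl | adjacency-nonadj {i} {i} (adj-irrefl refl) = refl

    entry-adj : ∀ {i j} → j ≢ i → Adj i j → entry i j ≡ ℤ.-1ℤ ∷ []
    entry-adj {i} {j} j≢i a
      rewrite dec-false (i Fin.≟ j) (j≢i ∘ sym) | adjacency-adj a = refl

    entry-nonadj : ∀ {i j} → j ≢ i → ¬ Adj i j → entry i j ≡ ℤ.0ℤ ∷ []
    entry-nonadj {i} {j} j≢i ¬a
      rewrite dec-false (i Fin.≟ j) (j≢i ∘ sym) | adjacency-nonadj ¬a = refl

  module _ {m} (k-odd : Odd (3 + m)) (k≤n : 3 + m ≤ n) (noShorter : NoOddCycleBelow (3 + m)) where

    private
      k = 3 + m

      Π : Vec (Fin n) n → List ℤ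
      Π σ = product ℤ[X] (map (λ i → entry i (lookup σ i)) (allFin n))

      moved? : ∀ (σ : Vec (Fin n) n) → Decidable (λ i → lookup σ i ≢ i)
      moved? σ i = ¬? (lookup σ i Fin.≟ i)

      Π-contributes : ∀ σ → Contributes k (lookup σ) → coeff ℤ-ring (Π σ) (n ∸ k) ≡ ℤ.-1ℤ
      Π-contributes σ (#moved , edges) = begin
        coeff ℤ-ring (Π σ) (n ∸ k)
          ≡⟨ coeff-product {Q = λ i → Adj i (lookup σ i)} (moved? σ) (λ i → entry i (lookup σ i))
               (entry-diagonal ∘ decidable-stable (_ Fin.≟ _)) entry-adj entry-nonadj
               (λ i → adj? i (lookup σ i)) (allFin n) (n ∸ k)
               -- `n ∸ k` counts the fixed points; `k≤n` makes the truncated subtraction exact.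
               (trans (cong (λ l → n ∸ k + l) #moved) (trans (ℕ.m∸n+n≡m k≤n) (sym (List.length-tabulate id))))
               (λ _ → edges _) ⟩
        ℤ.-1ℤ ℤ.^ length (moved (lookup σ)) ≡⟨ -1^odd (subst Odd (sym #moved) k-odd) ⟩
        ℤ.-1ℤ                               ∎
        where open ≡-Reasoning

      Π-vanishes : ∀ σ → ¬ Contributes k (lookup σ) → coeff ℤ-ring (Π σ) (n ∸ k) ≡ ℤ.0ℤ
      Π-vanishes σ ¬contributes = decidable-stable (_ ℤ.≟ ℤ.0ℤ) λ ≢0 →
        let eq , edges = coeff-product≢0 {Q = λ i → Adj i (lookup σ i)} (moved? σ)
                           (λ i → entry i (lookup σ i))
                           (entry-diagonal ∘ decidable-stable (_ Fin.≟ _)) entry-adj entry-nonadj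
                           (λ i → adj? i (lookup σ i)) (allFin n) (n ∸ k) ≢0
        in ¬contributes
             ( ℕ.+-cancelˡ-≡ (n ∸ k) _ _
                 (trans eq (trans (List.length-tabulate id) (sym (ℕ.m∸n+n≡m k≤n))))
             , λ x → edges (∈-allFin x))

    c-oddCycle : c A k ≡ ℤ.- (+ (length (cycles G k) + length (cycles G k)))
    c-oddCycle = begin
      c A k
        ≡⟨ sum-indicator good? _ ℤ.-1ℤ (n ∸ k) (permutations n) term-contributes (λ {σ} → term-vanishes σ) ⟩
      + length (filter good? (permutations n)) ℤ.* ℤ.-1ℤ
        ≡⟨ cong (λ l → + l ℤ.* ℤ.-1ℤ) (#contributing m k-odd noShorter) ⟩
      + (#cycles + #cycles) ℤ.* ℤ.-1ℤ
        ≡⟨ ℤ.*-comm _ ℤ.-1ℤ ⟩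
      ℤ.-1ℤ ℤ.* + (#cycles + #cycles)
        ≡⟨ ℤ.-1*i≡-i _ ⟩
      ℤ.- (+ (#cycles + #cycles)) ∎
      where
      open ≡-Reasoning
      #cycles = length (cycles G k)
      good? = λ σ → contributes? k (lookup σ)

      term-contributes : ∀ {σ} → σ ∈ permutations n → Contributes k (lookup σ) →
        coeff ℤ-ring (_⊛_ ℤ-ring (sign ℤ[X] σ) (Π σ)) (n ∸ k) ≡ ℤ.-1ℤ
      term-contributes {σ} σ∈ good = begin
        coeff ℤ-ring (_⊛_ ℤ-ring (sign ℤ[X] σ) (Π σ)) (n ∸ k)
          ≡⟨ cong (λ p → coeff ℤ-ring (_⊛_ ℤ-ring p (Π σ)) (n ∸ k)) (sign-even σ even) ⟩
        coeff ℤ-ring (_⊛_ ℤ-ring (ℤ.1ℤ ∷ []) (Π σ)) (n ∸ k)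
          ≡⟨ coeff-const-⊛ ℤ.1ℤ (Π σ) (n ∸ k) ⟩
        ℤ.1ℤ ℤ.* coeff ℤ-ring (Π σ) (n ∸ k)
          ≡⟨ ℤ.*-identityˡ _ ⟩
        coeff ℤ-ring (Π σ) (n ∸ k)
          ≡⟨ Π-contributes σ good ⟩
        ℤ.-1ℤ ∎
        where
        σ! = proj₂ (∈-filter⁻ unique? {xs = words n n} σ∈)
        order = proj₂ (contributes⇒traces (lookup σ) (VecUnique.lookup-injective σ! _ _)
                        k-odd noShorter good)
        even = inversions-oddOrder σ (proj₁ k-odd)
                 (λ x → subst (λ j → fold x (lookup σ) j ≡ x) (proj₂ k-odd) (order x))

      term-vanishes : ∀ σ → ¬ Contributes k (lookup σ) →
        coeff ℤ-ring (_⊛_ ℤ-ring (sign ℤ[X] σ) (Π σ)) (n ∸ k) ≡ ℤ.0ℤ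
      term-vanishes σ ¬good with sign-constant σ
      ... | s , eq = begin
        coeff ℤ-ring (_⊛_ ℤ-ring (sign ℤ[X] σ) (Π σ)) (n ∸ k)
          ≡⟨ cong (λ p → coeff ℤ-ring (_⊛_ ℤ-ring p (Π σ)) (n ∸ k)) eq ⟩
        coeff ℤ-ring (_⊛_ ℤ-ring (s ∷ []) (Π σ)) (n ∸ k)
          ≡⟨ coeff-const-⊛ s (Π σ) (n ∸ k) ⟩
        s ℤ.* coeff ℤ-ring (Π σ) (n ∸ k)
          ≡⟨ cong (s ℤ.*_) (Π-vanishes σ ¬good) ⟩
        s ℤ.* ℤ.0ℤ
          ≡⟨ ℤ.*-zeroʳ s ⟩
        ℤ.0ℤ ∎

-- Evaluation at w = r = 1

-- A ring map to the integers, in a form that passes from `R` to `R [X]` and so can be applied twice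
-- for `ℤ[w,r]`. The last field is separate because a polynomial equal to zero may be a nonempty
-- list of zeros.
record IsEvaluation (R : RawRing 0ℓ 0ℓ) (ε : RawRing.Carrier R → ℤ) : Set where
  private module R = RawRing R
  field
    +-homo : ∀ x y → ε (x R.+ y) ≡ ε x ℤ.+ ε y
    *-homo : ∀ x y → ε (x R.* y) ≡ ε x ℤ.* ε y
    0-homo : ε R.0# ≡ ℤ.0ℤ
    1-homo : ε R.1# ≡ ℤ.1ℤ
    ≈0⇒≡0  : ∀ x → x R.≈ R.0# → ε x ≡ ℤ.0ℤ

module _ {R : RawRing 0ℓ 0ℓ} {ε : RawRing.Carrier R → ℤ} (ε-eval : IsEvaluation R ε) where
  open RawRing R using (Carrier; _≈_; 0#; 1#) renaming (_+_ to _⊞_; _*_ to _⊠_)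
  open IsEvaluation ε-eval

  private
    ε₁ : List Carrier → ℤ
    ε₁ p = ε (eval R 1# p)

    ε₁-∷ : ∀ a p → ε₁ (a ∷ p) ≡ ε a ℤ.+ ε₁ p
    ε₁-∷ a p = begin
      ε (a ⊞ (1# ⊠ eval R 1# p))   ≡⟨ +-homo a (1# ⊠ eval R 1# p) ⟩
      ε a ℤ.+ ε (1# ⊠ eval R 1# p) ≡⟨ cong (λ z → ε a ℤ.+ z) (*-homo 1# (eval R 1# p)) ⟩
      ε a ℤ.+ ε 1# ℤ.* ε₁ p      ≡⟨ cong (λ z → ε a ℤ.+ z ℤ.* ε₁ p) 1-homo ⟩
      ε a ℤ.+ ℤ.1ℤ ℤ.* ε₁ p      ≡⟨ cong (λ z → ε a ℤ.+ z) (ℤ.*-identityˡ _) ⟩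
      ε a ℤ.+ ε₁ p               ∎
      where open ≡-Reasoning

    ε₁-⊕ : ∀ p q → ε₁ (_⊕_ R p q) ≡ ε₁ p ℤ.+ ε₁ q
    ε₁-⊕ []      q       = sym (trans (cong (λ z → z ℤ.+ ε₁ q) 0-homo) (ℤ.+-identityˡ _))
    ε₁-⊕ (a ∷ p) []      = sym (trans (cong (λ z → ε₁ (a ∷ p) ℤ.+ z) 0-homo) (ℤ.+-identityʳ _))
    ε₁-⊕ (a ∷ p) (b ∷ q) = begin
      ε₁ ((a ⊞ b) ∷ _⊕_ R p q)            ≡⟨ ε₁-∷ (a ⊞ b) (_⊕_ R p q) ⟩
      ε (a ⊞ b) ℤ.+ ε₁ (_⊕_ R p q)        ≡⟨ cong₂ ℤ._+_ (+-homo a b) (ε₁-⊕ p q) ⟩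
      ε a ℤ.+ ε b ℤ.+ (ε₁ p ℤ.+ ε₁ q)     ≡⟨ +-interchange (ε a) (ε b) (ε₁ p) (ε₁ q) ⟩
      ε a ℤ.+ ε₁ p ℤ.+ (ε b ℤ.+ ε₁ q)     ≡⟨ cong₂ ℤ._+_ (ε₁-∷ a p) (ε₁-∷ b q) ⟨
      ε₁ (a ∷ p) ℤ.+ ε₁ (b ∷ q)           ∎
      where
      open ≡-Reasoning
      +-interchange = interchange (CommutativeMonoid.commutativeSemigroup ℤ.+-0-commutativeMonoid)

    ε₁-scale : ∀ a p → ε₁ (map (a ⊠_) p) ≡ ε a ℤ.* ε₁ p
    ε₁-scale a []      = trans 0-homo (sym (trans (cong (λ z → ε a ℤ.* z) 0-homo) (ℤ.*-zeroʳ (ε a))))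
    ε₁-scale a (b ∷ p) = begin
      ε₁ ((a ⊠ b) ∷ map (a ⊠_) p)        ≡⟨ ε₁-∷ (a ⊠ b) (map (a ⊠_) p) ⟩
      ε (a ⊠ b) ℤ.+ ε₁ (map (a ⊠_) p)  ≡⟨ cong₂ ℤ._+_ (*-homo a b) (ε₁-scale a p) ⟩
      ε a ℤ.* ε b ℤ.+ ε a ℤ.* ε₁ p     ≡⟨ ℤ.*-distribˡ-+ (ε a) (ε b) (ε₁ p) ⟨
      ε a ℤ.* (ε b ℤ.+ ε₁ p)           ≡⟨ cong (λ z → ε a ℤ.* z) (ε₁-∷ b p) ⟨
      ε a ℤ.* ε₁ (b ∷ p)               ∎
      where open ≡-Reasoning

    ε₁-⊛ : ∀ p q → ε₁ (_⊛_ R p q) ≡ ε₁ p ℤ.* ε₁ q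
    ε₁-⊛ []      q = trans 0-homo (sym (trans (cong (λ z → z ℤ.* ε₁ q) 0-homo) (ℤ.*-zeroˡ (ε₁ q))))
    ε₁-⊛ (a ∷ p) q = begin
      ε₁ (_⊕_ R (map (a ⊠_) q) (0# ∷ _⊛_ R p q))  ≡⟨ ε₁-⊕ (map (a ⊠_) q) (0# ∷ _⊛_ R p q) ⟩
      ε₁ (map (a ⊠_) q) ℤ.+ ε₁ (0# ∷ _⊛_ R p q)   ≡⟨ cong₂ ℤ._+_ (ε₁-scale a q) (ε₁-∷ 0# (_⊛_ R p q)) ⟩
      ε a ℤ.* ε₁ q ℤ.+ (ε 0# ℤ.+ ε₁ (_⊛_ R p q))  ≡⟨ cong (λ z → ε a ℤ.* ε₁ q ℤ.+ z)
                                                       (trans (cong₂ ℤ._+_ 0-homo (ε₁-⊛ p q)) (ℤ.+-identityˡ _)) ⟩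
      ε a ℤ.* ε₁ q ℤ.+ ε₁ p ℤ.* ε₁ q              ≡⟨ ℤ.*-distribʳ-+ (ε₁ q) (ε a) (ε₁ p) ⟨
      (ε a ℤ.+ ε₁ p) ℤ.* ε₁ q                     ≡⟨ cong (λ z → z ℤ.* ε₁ q) (ε₁-∷ a p) ⟨
      ε₁ (a ∷ p) ℤ.* ε₁ q                         ∎
      where open ≡-Reasoning

    ε₁-≈0 : ∀ p → (∀ i → coeff R p i ≈ 0#) → ε₁ p ≡ ℤ.0ℤ
    ε₁-≈0 []      p≈0 = 0-homo
    ε₁-≈0 (a ∷ p) p≈0 = trans (ε₁-∷ a p)
      (cong₂ ℤ._+_ (≈0⇒≡0 a (p≈0 zero)) (ε₁-≈0 p (p≈0 ∘ suc)))

  evaluation-at-1 : IsEvaluation (R [X]) (λ p → ε (eval R 1# p))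
  evaluation-at-1 = record
    { +-homo = ε₁-⊕
    ; *-homo = ε₁-⊛
    ; 0-homo = 0-homo
    ; 1-homo = trans (ε₁-∷ 1# []) (cong₂ ℤ._+_ 1-homo 0-homo)
    ; ≈0⇒≡0  = ε₁-≈0
    }

  evaluation-sum : ∀ {A : Set} (f : A → Carrier) xs → (∀ {x} → x ∈ xs → ε (f x) ≡ ℤ.1ℤ) →
                   ε (sum R (map f xs)) ≡ + length xs
  evaluation-sum f []       f≡1 = 0-homo
  evaluation-sum f (x ∷ xs) f≡1 = trans (+-homo (f x) _)
    (cong₂ ℤ._+_ (f≡1 (here refl)) (evaluation-sum f xs (f≡1 ∘ there)))

  evaluation-product : ∀ {A : Set} (f : A → Carrier) {xs} → ListAll.All (λ x → ε (f x) ≡ ℤ.1ℤ) xs →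
                       ε (product R (map f xs)) ≡ ℤ.1ℤ
  evaluation-product f []                   = 1-homo
  evaluation-product f (_∷_ {x = x} fx fxs) = trans (*-homo (f x) _)
    (cong₂ ℤ._*_ fx (evaluation-product f fxs))

  -- `M` is `weight` for the components of `CWR` and `weightedAdjacency` for the conclusion; a cycle
  -- meets it only at edges, where both have value 1.
  evaluation-cycleSum : (G : WeightedSimpleGraph Carrier) → let open WeightedSimpleGraph G in
    (M : Matrix Carrier n) → (∀ {i j} → Adj i j → ε (M i j) ≡ ℤ.1ℤ) →
    ∀ k → ε (cycleSum R G k M) ≡ + length (cycles G k)
  evaluation-cycleSum G M M≡1 k = evaluation-sum _ (cycles G k) λ u∈ →
    let _ , adj , _ = proj₂ (∈-filter⁻ (isCycle? G) {xs = words _ k} u∈)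
    in evaluation-product _ (All.toList⁺ (All.map M≡1 adj))

evaluation-w=r=1 : IsEvaluation ℤ[w,r] _∣w=r=1
evaluation-w=r=1 = evaluation-at-1 (evaluation-at-1 record
  { +-homo = λ _ _ → refl
  ; *-homo = λ _ _ → refl
  ; 0-homo = refl
  ; 1-homo = refl
  ; ≈0⇒≡0  = λ _ → id
  })

-- Odd girth and the coefficient of the characteristic polynomial

hasCycle⇒cycles≢0 : ∀ {W : Set} (G : WeightedSimpleGraph W) {k} →
                    HasCycle G k → length (cycles G k) ≢ 0
hasCycle⇒cycles≢0 G {k} (u , cyc) with cycles G k | ∈-filter⁺ (isCycle? G) (words-complete u) cyc
... | _ ∷ _ | _ = λ ()

noOddCycleBelow : ∀ {W : Set} (G : WeightedSimpleGraph W) q →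
  (∀ p → 1 ≤ p → p < q → ¬ HasCycle G (2 * p + 1)) →
  CyclicPermutations.NoOddCycleBelow G (2 * q + 1)
-- Length 1 precedes the range of `noCycle`; a word of one letter is never `Canonical`.
noOddCycleBelow G q noCycle _ (zero , refl)  _  (_ ∷ [] , _ , _ , ())
noOddCycleBelow G q noCycle l (suc h , refl) lt cyc =
  noCycle (suc h) (s≤s z≤n)
    (ℕ.*-cancelˡ-< 2 (suc h) q (ℕ.+-cancelʳ-< 1 _ _ (subst (_< 2 * q + 1) odd≡ lt)))
    (subst (HasCycle G) odd≡ cyc)
  where
  odd≡ : suc (suc h + suc h) ≡ 2 * suc h + 1
  odd≡ = trans (cong (λ j → suc (suc h + j)) (sym (ℕ.+-identityʳ (suc h)))) (ℕ.+-comm 1 (2 * suc h))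

c-oddGirth : ∀ {W : Set} (G : WeightedSimpleGraph W) q → 1 ≤ q → 2 * q + 1 ≤ WeightedSimpleGraph.n G →
  (∀ p → 1 ≤ p → p < q → ¬ HasCycle G (2 * p + 1)) →
  c (adjacency G) (2 * q + 1) ≡
    ℤ.- (+ (length (cycles G (2 * q + 1)) + length (cycles G (2 * q + 1))))
c-oddGirth G (suc q) _ k≤n noCycle = subst
  (λ k → k ≤ WeightedSimpleGraph.n G → CyclicPermutations.NoOddCycleBelow G k →
         c (adjacency G) k ≡ ℤ.- (+ (length (cycles G k) + length (cycles G k))))
  (sym 2[1+q]+1≡3+q+q)
  -- Here `q` is already the predecessor, so the length is 3 + (q + q), twice `suc q` plus one.
  (CharacteristicPolynomial.c-oddCycle G (suc q , cong (λ j → suc (suc j)) (sym (ℕ.+-suc q q))))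
  k≤n (noOddCycleBelow G (suc q) noCycle)
  where
  2[1+q]+1≡3+q+q : 2 * suc q + 1 ≡ 3 + (q + q)
  2[1+q]+1≡3+q+q = trans (ℕ.+-comm (2 * suc q) 1)
    (cong (λ j → suc (suc j)) (trans (cong (λ j → q + j) (ℕ.+-identityʳ (suc q))) (ℕ.+-suc q q)))

-- Halving in the rationals

toℚᵘ-/ : ∀ i d → toℚᵘ (i / suc d) ≃ mkℚᵘ i d
toℚᵘ-/ i d = ℚ.toℚᵘ-fromℚᵘ (mkℚᵘ i d)

doubled : ∀ N → + N ℤ.* + 2 ≡ + (N + N)
doubled N = trans (sym (ℤ.pos-* N 2))
  (cong +_ (trans (ℕ.*-comm N 2) (cong (λ j → N + j) (ℕ.+-identityʳ N))))

-- Division in ℚ reduces to lowest terms and is stuck on a variable numerator; among unnormalised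
-- fractions the claim is an integer cross-multiplication.
minusHalf-double : ∀ N → + N / 1 ≡ -½ ℚ.* (ℤ.- (+ (N + N)) / 1)
minusHalf-double N = ℚ.toℚᵘ-injective (begin
  toℚᵘ (+ N / 1)                              ≈⟨ toℚᵘ-/ (+ N) 0 ⟩
  mkℚᵘ (+ N) 0                                ≈⟨ *≡* crossMultiplied ⟩
  mkℚᵘ ℤ.-1ℤ 1 ℚᵘ.* mkℚᵘ (ℤ.- (+ (N + N))) 0  ≈⟨ ℚᵘ.*-congˡ {mkℚᵘ ℤ.-1ℤ 1} (toℚᵘ-/ (ℤ.- (+ (N + N))) 0) ⟨
  toℚᵘ -½ ℚᵘ.* toℚᵘ (ℤ.- (+ (N + N)) / 1)     ≈⟨ ℚ.toℚᵘ-homo-* -½ (ℤ.- (+ (N + N)) / 1) ⟨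
  toℚᵘ (-½ ℚ.* (ℤ.- (+ (N + N)) / 1))         ∎)
  where
  open import Relation.Binary.Reasoning.Setoid ℚᵘ.≃-setoid
  crossMultiplied : + N ℤ.* + 2 ≡ ℤ.-1ℤ ℤ.* ℤ.- (+ (N + N)) ℤ.* ℤ.1ℤ
  crossMultiplied = trans (doubled N) (sym (trans (ℤ.*-identityʳ _)
    (trans (ℤ.-1*i≡-i _) (ℤ.neg-involutive _))))

half-double : ∀ N → + N / 1 ≡ ℤ.- (ℤ.- (+ (N + N))) / 2
half-double N = ℚ.fromℚᵘ-cong {mkℚᵘ (+ N) 0} {mkℚᵘ (ℤ.- (ℤ.- (+ (N + N)))) 1} (*≡*
  (trans (doubled N) (sym (trans (ℤ.*-identityʳ _) (ℤ.neg-involutive _)))))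

-- Tait graphs at w = r = 1

module _ (D : Diagram) (reduced : Reduced D) {ρ} (χ : Checkerboard D ρ) where

  -- Every factor is `w` or `r`, of value 1; for regions sharing no crossing the product is empty,
  -- again of value 1.
  evaluation-parallelWeight : ∀ s t → parallelWeight D reduced χ s t ∣w=r=1 ≡ ℤ.1ℤ
  evaluation-parallelWeight s t = evaluation-product evaluation-w=r=1 (wg D)
    {filter (joins? D reduced χ s t) (allFin _)} (ListAll.universal wg≡1 _)
    where
    wg≡1 : ∀ x → wg D x ∣w=r=1 ≡ ℤ.1ℤ
    wg≡1 x with does (Diagram.outward D (x , zero) Bool.≟ Diagram.outward D (x , suc (suc (suc zero))))
    ... | true  = refl
    ... | false = refl

  evaluation-weight : ∀ κ i j →
    WeightedSimpleGraph.weight (consolidatedTait D reduced χ κ) i j ∣w=r=1 ≡ ℤ.1ℤ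
  evaluation-weight κ i j = evaluation-parallelWeight _ _

  evaluation-weightedAdjacency : ∀ κ → let G = consolidatedTait D reduced χ κ in
    ∀ {i j} → WeightedSimpleGraph.Adj G i j → weightedAdjacency ℤ[w,r] G i j ∣w=r=1 ≡ ℤ.1ℤ
  evaluation-weightedAdjacency κ {i} {j} adj
    rewrite dec-true (WeightedSimpleGraph.adj? (consolidatedTait D reduced χ κ) i j) adj =
    evaluation-weight κ i j

  evaluation-CWR : ∀ κ k → component κ (CWR D reduced χ k) ∣w=r=1 ≡
                           + length (cycles (consolidatedTait D reduced χ κ) k)
  evaluation-CWR black = evaluation-cycleSum evaluation-w=r=1 _ _ λ {i} {j} _ → evaluation-weight black i j
  evaluation-CWR white = evaluation-cycleSum evaluation-w=r=1 _ _ λ {i} {j} _ → evaluation-weight white i j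

  -- Each cycle contributes exactly 1 to the value at w = r = 1, so nothing can cancel and a zero
  -- value means an empty list of cycles.
  CWR≈0⇒¬hasCycle : ∀ κ k →
    RawRing._≈_ ℤ[w,r] (component κ (CWR D reduced χ k)) (RawRing.0# ℤ[w,r]) →
    ¬ HasCycle (consolidatedTait D reduced χ κ) k
  CWR≈0⇒¬hasCycle κ k CWR≈0 cyc = hasCycle⇒cycles≢0 _ cyc (ℤ.+-injective
    (trans (sym (evaluation-CWR κ k))
      (IsEvaluation.≈0⇒≡0 evaluation-w=r=1 (component κ (CWR D reduced χ k)) CWR≈0)))

corollary7p2 :
  (D : Diagram) → Alternating D → (reduced : Reduced D) →
  (ρ : Colour) (χ : Checkerboard D ρ) (κ : Colour) →
  let G = consolidatedTait D reduced χ κ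
      n = WeightedSimpleGraph.n G
      A = adjacency G
      Ā = weightedAdjacency ℤ[w,r] G
  in
  (q : ℕ) → 1 ≤ q → 2 * q + 1 ≤ n →
  ((∀ p → 1 ≤ p → p < q →
      RawRing._≈_ ℤ[w,r] (component κ (CWR D reduced χ (2 * p + 1))) (RawRing.0# ℤ[w,r])) →
    (cycleSum ℤ[w,r] G (2 * q + 1) Ā ∣w=r=1) / 1 ≡ -½ ℚ.* (c A (2 * q + 1) / 1))
  ×
  (ShortestOddCycleLength G (2 * q + 1) →
    (+ length (cycles G (2 * q + 1))) / 1 ≡ (ℤ.- c A (2 * q + 1)) / 2)
corollary7p2 D _ reduced ρ χ κ q 1≤q k≤n = countByWeight , countShortest
  where
  G = consolidatedTait D reduced χ κ

  N = length (cycles G (2 * q + 1))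

  countByWeight :
    (∀ p → 1 ≤ p → p < q →
      RawRing._≈_ ℤ[w,r] (component κ (CWR D reduced χ (2 * p + 1))) (RawRing.0# ℤ[w,r])) →
    (cycleSum ℤ[w,r] G (2 * q + 1) (weightedAdjacency ℤ[w,r] G) ∣w=r=1) / 1 ≡
      -½ ℚ.* (c (adjacency G) (2 * q + 1) / 1)
  countByWeight CWR≈0 = begin
    (cycleSum ℤ[w,r] G (2 * q + 1) (weightedAdjacency ℤ[w,r] G) ∣w=r=1) / 1
      ≡⟨ cong (_/ 1) (evaluation-cycleSum evaluation-w=r=1 G _
           (evaluation-weightedAdjacency D reduced χ κ) (2 * q + 1)) ⟩
    + N / 1
      ≡⟨ minusHalf-double N ⟩
    -½ ℚ.* (ℤ.- (+ (N + N)) / 1)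
      ≡⟨ cong (λ z → -½ ℚ.* (z / 1)) (c-oddGirth G q 1≤q k≤n λ p 1≤p p<q →
           CWR≈0⇒¬hasCycle D reduced χ κ (2 * p + 1) (CWR≈0 p 1≤p p<q)) ⟨
    -½ ℚ.* (c (adjacency G) (2 * q + 1) / 1) ∎
    where open ≡-Reasoning

  countShortest : ShortestOddCycleLength G (2 * q + 1) →
                  + N / 1 ≡ (ℤ.- c (adjacency G) (2 * q + 1)) / 2
  countShortest (_ , _ , shortest) = trans (half-double N) (cong (λ z → (ℤ.- z) / 2)
    (sym (c-oddGirth G q 1≤q k≤n λ p _ p<q cyc →
      ℕ.<⇒≱ (ℕ.+-monoˡ-< 1 (ℕ.*-monoʳ-< 2 p<q)) (shortest _ (p , refl) cyc))))
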